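{- For any type $\sigma$ and any programs $M,N:\sigma$, we have $M\approx_{T_3}N$ if and only if $M\approx_{\mathrm{Ob}_{\mathrm{VDis}}}N$.
   Context: **Language.** Fix base types $b$, including $\mathtt{Bool}$ and $\mathtt{Rew}$; for each $b$ a set of constants $c:b$ (including $\mathtt{tt},\mathtt{ff}:\mathtt{Bool}$, $0:\mathtt{Rew}$); and function symbols $f:b_1\ldots b_m\to b$, including $=_b\,:b\,b\to\mathtt{Bool}$ for each $b$, $+:\mathtt{Rew}\,\mathtt{Rew}\to\mathtt{Rew}$, $\oplus_p:\mathtt{Rew}\,\mathtt{Rew}\to\mathtt{Rew}$ ($p\in[0,1]$) and $\le\,:\mathtt{Rew}\,\mathtt{Rew}\to\mathtt{Bool}$. Types: $\sigma::=b\mid\mathtt{Unit}\mid\sigma\times\sigma\mid\sigma\to\sigma$. Terms: $M::=x\mid c\mid f(M_1,\dots,M_m)\mid\mathtt{if}\,L\,\mathtt{then}\,M\,\mathtt{else}\,N\mid M\,\mathtt{or}\,N\mid N\cdot M\mid M+_pN\ (p\in[0,1])\mid *\mid\langle M,N\rangle\mid\mathtt{fst}(M)\mid\mathtt{snd}(M)\mid\lambda x{:}\sigma.M\mid MN$, up to $\alpha$-equivalence, with standard simple typing; $M\,\mathtt{or}\,N$ and $M+_pN$ have type $\sigma$ when $M,N:\sigma$, and $N\cdot M:\sigma$ when $N:\mathtt{Rew}$, $M:\sigma$. Programs are closed well-typed terms. Values (closed): $V::=c\mid *\mid\langle V,W\rangle\mid\lambda x{:}\sigma.M$; $\mathrm{Val}_\sigma$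 is the set of values of type $\sigma$. Effect values: $E::=V\mid E_1\,\mathtt{or}\,E_2\mid c\cdot E\mid E_1+_pE_2$ ($c:\mathtt{Rew}$). **Ordinary operational semantics.** Evaluation contexts (closed): $\mathcal E::=[\,]\mid f(c_1,\dots,c_{k-1},\mathcal E,M_{k+1},\dots,M_m)\mid\mathtt{if}\,\mathcal E\,\mathtt{then}\,M\,\mathtt{else}\,N\mid\mathcal E\cdot M\mid\langle\mathcal E,N\rangle\mid\langle V,\mathcal E\rangle\mid\mathtt{fst}(\mathcal E)\mid\mathtt{snd}(\mathcal E)\mid\mathcal EN\mid(\lambda x{:}\sigma.M)\mathcal E$. Constants $\mathrm{val}_f(c_1,\dots,c_m):b$ are given for all $f$ and $c_i:b_i$, with $\mathrm{val}_{=_b}(c,c')=\mathtt{tt}$ if $c=c'$, else $\mathtt{ff}$. Steps $\mathcal E[Q]\to\mathcal E[Q']$ arise from: $f(c_1,\dots,c_m)\to\mathrm{val}_f(c_1,\dots,c_m)$; $\mathtt{if}\,\mathtt{tt}\,\mathtt{then}\,M\,\mathtt{else}\,N\to M$; $\mathtt{if}\,\mathtt{ff}\,\mathtt{then}\,M\,\mathtt{else}\,N\to N$; $\mathtt{fst}\langle V,W\rangle\to V$; $\mathtt{snd}\langle V,W\rangle\to W$; $(\lambda x{:}\sigma.M)V\to M[V/x]$. Evaluation is deterministic and terminating, and each program $M:\sigma$ has an effect value $\mathrm{Op}(M):\sigma$ determined by $\mathrm{Op}(V)=V$; $\mathrm{Op}(M)=\mathrm{Op}(M')$ if $M\to M'$;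 $\mathrm{Op}(\mathcal E[M_1\,\mathtt{or}\,M_2])=\mathrm{Op}(\mathcal E[M_1])\,\mathtt{or}\,\mathrm{Op}(\mathcal E[M_2])$; $\mathrm{Op}(\mathcal E[M_1+_pM_2])=\mathrm{Op}(\mathcal E[M_1])+_p\mathrm{Op}(\mathcal E[M_2])$; $\mathrm{Op}(\mathcal E[c\cdot M_1])=c\cdot\mathrm{Op}(\mathcal E[M_1])$. **Rewards and interpretation.** A barycentric algebra is a set with binary operations $+_p$ ($p\in[0,1]$) such that $x+_1y=x$, $x+_px=x$, $x+_py=y+_{1-p}x$ and $(x+_py)+_qz=x+_{pq}(y+_{(1-p)q/(1-pq)}z)$ for $p,q<1$; finite convex combinations $\sum_ip_ix_i$ are then defined as usual. $R$ is a set with a barycentric algebra structure $+_p$, a commutative monoid structure $(+,0)$ with $r+(s+_ps')=(r+s)+_p(r+s')$, and a total order $\le$ such that for all $r,s,t$: $r\le s\iff r+t\le s+t$, and $r\le s\iff r+_pt\le s+_pt$ for $p\in(0,1)$. It is additionally assumed that $(r+x)+_p(s+y)=((r+_ps)+x)+_p((r+_ps)+y)$ for all $r,s,x,y\in R$, $p\in[0,1]$. Given are nonempty sets $[\![b]\!]$ with $[\![\mathtt{Bool}]\!]=\{0,1\}$, $[\![\mathtt{Rew}]\!]=R$; elements $[\![c]\!]\in[\![b]\!]$ for $c:b$ with $[\![\mathtt{tt}]\!]=1$, $[\![\mathtt{ff}]\!]=0$, $[\![0]\!]=0$, distinct constants of the same type having distinct denotations, and $[\![c]\!]\ne0$ for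 some $c:\mathtt{Rew}$; and functions $[\![f]\!]:[\![b_1]\!]\times\cdots\times[\![b_m]\!]\to[\![b]\!]$ with $[\![+]\!],[\![\oplus_p]\!],[\![\le]\!]$ the addition, the operation $+_p$ and the (characteristic function of the) order of $R$, and $[\![f]\!]([\![c_1]\!],\dots,[\![c_m]\!])=[\![\mathrm{val}_f(c_1,\dots,c_m)]\!]$. $DW(X)$ is the set of finitely supported probability distributions $\sum_ip_i\langle r_i,x_i\rangle$ on $R\times X$, with $r\cdot\sum_ip_i\langle r_i,x_i\rangle=\sum_ip_i\langle r+r_i,x_i\rangle$. The expected reward is $\mathbf E(\sum_ip_i\langle r_i,x_i\rangle)=\sum_ip_ir_i\in R$, and the value distribution is $\mathrm{VDis}(\sum_ip_i\langle r_i,x_i\rangle)=\sum_ip_ix_i$, a finite probability distribution on $X$. **Selection operational semantics.** Strategies: a value has the single strategy $*$; those of $E_1\,\mathtt{or}\,E_2$ are $1s$ ($s\in\mathrm{Str}(E_1)$) and $2s$ ($s\in\mathrm{Str}(E_2)$); those of $c\cdot E$ are those of $E$; those of $E_1+_pE_2$ are pairs $(s_1,s_2)$, $s_i\in\mathrm{Str}(E_i)$. Outcomes: $\mathrm{Out}(*,V)=\langle0,V\rangle$ (Dirac); $\mathrm{Out}(is,E_1\,\mathtt{or}\,E_2)=\mathrm{Out}(s,E_i)$; $\mathrm{Out}(s,c\cdot E)=[\![c]\!]\cdot\mathrm{Out}(s,E)$; $\mathrm{Out}((s_1,s_2),E_1+_pE_2)=p\,\mathrm{Out}(s_1,E_1)+(1-p)\,\mathrm{Out}(s_2,E_2)$.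 $\mathrm{Rew}(s,E)=\mathbf E(\mathrm{Out}(s,E))$. Strategies are totally ordered: on $E_1\,\mathtt{or}\,E_2$ all $1s$ precede all $2s'$, each group ordered as in $E_1$, resp. $E_2$; on $c\cdot E$ as in $E$; on $E_1+_pE_2$ lexicographically. $\mathrm{Op}_s(M)=\mathrm{Out}(s_{\rm opt},\mathrm{Op}(M))\in DW(\mathrm{Val}_\sigma)$, where $s_{\rm opt}$ is the least strategy of $\mathrm{Op}(M)$ maximizing $\mathrm{Rew}(s,\mathrm{Op}(M))$. **Observational equivalences.** For a function $\mathrm{Ob}$ on programs of type $\mathtt{Bool}$ and programs $M,N:\sigma$, $M\approx_{\mathrm{Ob}}N$ iff $\mathrm{Ob}(C[M])=\mathrm{Ob}(C[N])$ for every one-hole context $C[\;]$ such that $C[L]:\mathtt{Bool}$ is a program for every program $L:\sigma$. $\approx_{T_3}$ is $\approx_{\mathrm{Ob}}$ for $\mathrm{Ob}(M)=\mathrm{Ob}_{T_3}(M)=\langle\mathrm{VDis}(\mathrm{Op}_s(M)),\mathbf E(\mathrm{Op}_s(M))\rangle$, and $\mathrm{Ob}_{\mathrm{VDis}}(M)=\mathrm{VDis}(\mathrm{Op}_s(M))$. -}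

module Defs where

open import Algebra.Bundles using (CommutativeRing)
open import Algebra.Structures using (IsCommutativeRing; IsCommutativeMonoid)
import Algebra.Properties.Ring
open import Data.Bool.Base using (Bool; true; false; if_then_else_)
import Data.Bool.Properties as Bool
open import Data.Empty using (⊥; ⊥-elim; ⊥-elim-irr)
open import Data.List.Base using (List; []; _∷_; _++_; map)
open import Data.List.Membership.Propositional using (_∈_)
open import Data.List.Relation.Unary.All as All using (All; []; _∷_)
open import Data.List.Relation.Unary.Any using (here; there)
open import Data.Product.Base using (Σ; ∃; _×_; _,_; proj₁; proj₂)
open import Data.Product.Relation.Binary.Lex.Strict using (×-Lex)
open import Data.Product.Relation.Binary.Pointwise.NonDependent using (×-setoid)
open import Data.Sum.Base using (_⊎_; inj₁; inj₂)
open import Data.Sum.Relation.Binary.LeftOrder using (_⊎-<_; ₁∼₂; ₁∼₁; ₂∼₂)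
open import Data.Unit.Base using (⊤; tt)
open import Function.Base using (_∘_)
open import Function.Bundles using (_⇔_)
open import Function.Definitions using (Injective)
open import Level using (0ℓ)
open import Relation.Binary.Bundles using (Setoid)
open import Relation.Binary.Definitions using (DecidableEquality)
open import Relation.Binary.PropositionalEquality
  using (_≡_; _≢_; refl; sym; trans; cong; cong₂; subst; subst₂; setoid)
open import Relation.Binary.Structures using (IsDecTotalOrder)
open import Relation.Nullary.Decidable.Core using (yes; no; ⌊_⌋)
import Relation.Nullary.Decidable as Dec

-- The reals are given axiomatically, as a Dedekind-complete ordered
-- field.  Classical reasoning about them enters only through the
-- decidability of the order.

record Reals : Set₁ where
  infixl 6 _+_ _-_
  infixl 7 _*_
  infix  8 -_ _⁻¹
  infix  4 _≤_
  field
    ℝ       : Set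
    _+_ _*_ : ℝ → ℝ → ℝ
    -_      : ℝ → ℝ
    0# 1#   : ℝ
    _⁻¹     : ℝ → ℝ
    _≤_     : ℝ → ℝ → Set

    isCommutativeRing : IsCommutativeRing _≡_ _+_ _*_ -_ 0# 1#
    0≢1               : 0# ≢ 1#
    -- Nothing is said about 0# ⁻¹.
    ⁻¹-inverseʳ       : ∀ x → x ≢ 0# → x * x ⁻¹ ≡ 1#

    isDecTotalOrder   : IsDecTotalOrder _≡_ _≤_
    +-monoʳ-≤         : ∀ z {x y} → x ≤ y → z + x ≤ z + y
    *-nonneg          : ∀ {x y} → 0# ≤ x → 0# ≤ y → 0# ≤ x * y

    supremum : (P : ℝ → Set) → ∃ P → (∃ λ b → ∀ x → P x → x ≤ b) →
               ∃ λ s → (∀ x → P x → x ≤ s) ×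
                       (∀ b → (∀ x → P x → x ≤ b) → s ≤ b)

  commutativeRing : CommutativeRing 0ℓ 0ℓ
  commutativeRing = record { isCommutativeRing = isCommutativeRing }

  open CommutativeRing commutativeRing public
    using ( ring; +-assoc; +-comm; +-identityˡ; +-identityʳ; -‿inverseˡ; -‿inverseʳ
          ; *-assoc; *-comm; *-identityˡ; *-identityʳ; distribˡ; distribʳ; zeroˡ; zeroʳ )
  open IsDecTotalOrder isDecTotalOrder public
    using (_≟_; _≤?_)
    renaming (refl to ≤-refl; trans to ≤-trans; antisym to ≤-antisym; total to ≤-total)

  _-_ : ℝ → ℝ → ℝ
  x - y = x + - y

module RealProperties (𝓡 : Reals) where
  open Reals 𝓡
  private
    module Rg = Algebra.Properties.Ring ring

  a-b+b : ∀ a b → a - b + b ≡ a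
  a-b+b a b = trans (+-assoc a (- b) b) (trans (cong (a +_) (-‿inverseˡ b)) (+-identityʳ a))

  a≤b⇒0≤b-a : ∀ {a b} → a ≤ b → 0# ≤ b - a
  a≤b⇒0≤b-a {a} {b} h =
    subst₂ _≤_ (-‿inverseˡ a) (+-comm (- a) b) (+-monoʳ-≤ (- a) h)

  0≤b-a⇒a≤b : ∀ {a b} → 0# ≤ b - a → a ≤ b
  0≤b-a⇒a≤b {a} {b} h =
    subst₂ _≤_ (+-identityʳ a) (trans (+-comm a (b - a)) (a-b+b b a)) (+-monoʳ-≤ a h)

  a≤a+b : ∀ {a b} → 0# ≤ b → a ≤ a + b
  a≤a+b {a} {b} h = subst (_≤ a + b) (+-identityʳ a) (+-monoʳ-≤ a h)

  +-nonneg : ∀ {a b} → 0# ≤ a → 0# ≤ b → 0# ≤ a + b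
  +-nonneg ha hb = ≤-trans ha (a≤a+b hb)

  0≤a² : ∀ a → 0# ≤ a * a
  0≤a² a with ≤-total 0# a
  ... | inj₁ h = *-nonneg h h
  ... | inj₂ h = subst (0# ≤_) eq (*-nonneg h′ h′)
    where
    h′ : 0# ≤ - a
    h′ = subst (0# ≤_) (+-identityˡ (- a)) (a≤b⇒0≤b-a h)
    eq : (- a) * (- a) ≡ a * a
    eq = trans (sym (Rg.-‿distribˡ-* a (- a)))
               (trans (cong -_ (sym (Rg.-‿distribʳ-* a a))) (Rg.-‿involutive (a * a)))

  0≤1 : 0# ≤ 1#
  0≤1 = subst (0# ≤_) (*-identityˡ 1#) (0≤a² 1#)

  ⁻¹-nonneg : ∀ {b} → 0# ≤ b → b ≢ 0# → 0# ≤ b ⁻¹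
  ⁻¹-nonneg {b} hb b≢0 = subst (0# ≤_) eq (*-nonneg hb (0≤a² (b ⁻¹)))
    where
    eq : b * (b ⁻¹ * b ⁻¹) ≡ b ⁻¹
    eq = trans (sym (*-assoc b (b ⁻¹) (b ⁻¹)))
               (trans (cong (_* b ⁻¹) (⁻¹-inverseʳ b b≢0)) (*-identityˡ (b ⁻¹)))

  *-monoˡ-≤ : ∀ {a b} c → 0# ≤ c → a ≤ b → c * a ≤ c * b
  *-monoˡ-≤ {a} {b} c hc h =
    0≤b-a⇒a≤b (subst (0# ≤_) eq (*-nonneg hc (a≤b⇒0≤b-a h)))
    where
    eq : c * (b - a) ≡ c * b - c * a
    eq = trans (distribˡ c b (- a)) (cong (c * b +_) (sym (Rg.-‿distribʳ-* c a)))

  a*b≤a : ∀ {a b} → 0# ≤ a → b ≤ 1# → a * b ≤ a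
  a*b≤a {a} {b} ha hb = subst (a * b ≤_) (*-identityʳ a) (*-monoˡ-≤ a ha hb)

  ratio-≤1 : ∀ {a b} → 0# ≤ a → a ≤ b → b ≢ 0# → a * b ⁻¹ ≤ 1#
  ratio-≤1 {a} {b} ha hab b≢0 =
    subst₂ _≤_ (*-comm (b ⁻¹) a)
               (trans (*-comm (b ⁻¹) b) (⁻¹-inverseʳ b b≢0))
               (*-monoˡ-≤ (b ⁻¹) (⁻¹-nonneg (≤-trans ha hab) b≢0) hab)

  a-b≡0⇒a≡b : ∀ {a b} → a - b ≡ 0# → a ≡ b
  a-b≡0⇒a≡b {a} {b} h = trans (sym (a-b+b a b)) (trans (cong (_+ b) h) (+-identityˡ b))

  a+b≡c⇒b≡c-a : ∀ {a b c} → a + b ≡ c → b ≡ c - a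
  a+b≡c⇒b≡c-a {a} {b} refl =
    trans (sym (+-identityʳ b))
      (trans (cong (b +_) (sym (-‿inverseʳ a)))
        (trans (sym (+-assoc b a (- a))) (cong (_- a) (+-comm b a))))

module Probability (𝓡 : Reals) where
  open Reals 𝓡
  open RealProperties 𝓡

  -- The bounds are irrelevant: probabilities are equal when their values
  -- are.
  record Prob : Set where
    constructor prob
    field
      value    : ℝ
      .nonneg  : 0# ≤ value
      .atMost1 : value ≤ 1#
  open Prob public using (value)

  1ₚ : Prob
  1ₚ = prob 1# 0≤1 ≤-refl

  infixl 7 _*ₚ_
  _*ₚ_ : Prob → Prob → Prob
  prob p 0≤p p≤1 *ₚ prob q 0≤q q≤1 =
    prob (p * q) (*-nonneg 0≤p 0≤q) (≤-trans (a*b≤a 0≤p q≤1) p≤1)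

  1-_ : Prob → Prob
  1- prob p 0≤p p≤1 =
    prob (1# - p) (a≤b⇒0≤b-a p≤1)
         (0≤b-a⇒a≤b (subst (0# ≤_) (a+b≡c⇒b≡c-a (a-b+b 1# p)) 0≤p))

  ratio : (a b : ℝ) → .(0# ≤ a) → .(a ≤ b) → .(b ≢ 0#) → Prob
  ratio a b 0≤a a≤b b≢0 =
    prob (a * b ⁻¹) (*-nonneg 0≤a (⁻¹-nonneg (≤-trans 0≤a a≤b) b≢0)) (ratio-≤1 0≤a a≤b b≢0)

  -- (1 - p) q / (1 - p q)
  reassoc : (p q : Prob) → .(value p ≢ 1#) → Prob
  reassoc (prob p 0≤p p≤1) (prob q 0≤q q≤1) p≢1 =
    ratio ((1# - p) * q) (1# - p * q)
          (*-nonneg (a≤b⇒0≤b-a p≤1) 0≤q)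
          (num≤den q≤1)
          (λ e → p≢1 (≤-antisym p≤1 (subst (_≤ p) (sym (a-b≡0⇒a≡b e)) (a*b≤a 0≤p q≤1))))
    where
    num≤den : ∀ {a b} → b ≤ 1# → (1# - a) * b ≤ 1# - a * b
    num≤den {a} {b} hb = subst₂ _≤_ (sym eq) (+-comm (- (a * b)) 1#) (+-monoʳ-≤ (- (a * b)) hb)
      where
      eq : (1# - a) * b ≡ - (a * b) + b
      eq = trans (distribʳ b 1# (- a))
             (trans (cong₂ _+_ (*-identityˡ b) (sym (Algebra.Properties.Ring.-‿distribˡ-* ring a b)))
                    (+-comm b (- (a * b))))

record RewardStructure (𝓡 : Reals) : Set₁ where
  open Reals 𝓡 using (ℝ; 0#; 1#)
  open Probability 𝓡
  infixl 6 _+ᴿ_ _+[_]_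
  infix  4 _≤ᴿ_
  field
    R      : Set
    _+[_]_ : R → Prob → R → R
    _+ᴿ_   : R → R → R
    0ᴿ     : R
    _≤ᴿ_   : R → R → Set

    +[]-one   : ∀ x y → x +[ 1ₚ ] y ≡ x
    +[]-idem  : ∀ p x → x +[ p ] x ≡ x
    +[]-comm  : ∀ p x y → x +[ p ] y ≡ y +[ 1- p ] x
    +[]-assoc : ∀ p q x y z (p≢1 : value p ≢ 1#) → value q ≢ 1# →
                (x +[ p ] y) +[ q ] z ≡ x +[ p *ₚ q ] (y +[ reassoc p q p≢1 ] z)

    +ᴿ-isCommutativeMonoid : IsCommutativeMonoid _≡_ _+ᴿ_ 0ᴿ
    +ᴿ-distrib-+[] : ∀ p r s s′ → r +ᴿ (s +[ p ] s′) ≡ (r +ᴿ s) +[ p ] (r +ᴿ s′)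

    ≤ᴿ-isDecTotalOrder : IsDecTotalOrder _≡_ _≤ᴿ_
    ≤ᴿ-+ᴿ  : ∀ r s t → r ≤ᴿ s ⇔ r +ᴿ t ≤ᴿ s +ᴿ t
    ≤ᴿ-+[] : ∀ p r s t → value p ≢ 0# → value p ≢ 1# → r ≤ᴿ s ⇔ r +[ p ] t ≤ᴿ s +[ p ] t

    +[]-average : ∀ p r s x y →
      (r +ᴿ x) +[ p ] (s +ᴿ y) ≡ ((r +[ p ] s) +ᴿ x) +[ p ] ((r +[ p ] s) +ᴿ y)

  open IsDecTotalOrder ≤ᴿ-isDecTotalOrder public
    using ()
    renaming (_≤?_ to _≤ᴿ?_; refl to ≤ᴿ-refl; trans to ≤ᴿ-trans; total to ≤ᴿ-total)

data Base (Other : Set) : Set where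
  bool rew : Base Other
  other    : Other → Base Other

record Signature (𝓡 : Reals) : Set₁ where
  open Probability 𝓡
  field
    Other : Set
    Con   : Base Other → Set
    Fun   : List (Base Other) → Base Other → Set

    ttᶜ ffᶜ : Con bool
    0ᶜ      : Con rew

    eqᶠ   : ∀ b → Fun (b ∷ b ∷ []) bool
    plusᶠ : Fun (rew ∷ rew ∷ []) rew
    mixᶠ  : Prob → Fun (rew ∷ rew ∷ []) rew
    leqᶠ  : Fun (rew ∷ rew ∷ []) bool

    val     : ∀ {bs b} → Fun bs b → All Con bs → Con b
    val-eq  : ∀ {b} (c : Con b) → val (eqᶠ b) (c ∷ c ∷ []) ≡ ttᶜ
    val-neq : ∀ {b} (c c′ : Con b) → c ≢ c′ → val (eqᶠ b) (c ∷ c′ ∷ []) ≡ ffᶜ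

carrier : {Other : Set} → Set → (Other → Set) → Base Other → Set
carrier R O bool      = Bool
carrier R O rew       = R
carrier R O (other o) = O o

record Interpretation (𝓡 : Reals) (𝓢 : Signature 𝓡) (𝓦 : RewardStructure 𝓡) : Set₁ where
  open Signature 𝓢
  open RewardStructure 𝓦
  field
    ⟦_⟧ᵒ      : Other → Set
    inhabited : ∀ o → ⟦ o ⟧ᵒ

  ⟦_⟧ᵇ : Base Other → Set
  ⟦_⟧ᵇ = carrier R ⟦_⟧ᵒ

  field
    ⟦_⟧ᶜ : ∀ {b} → Con b → ⟦ b ⟧ᵇ
    ⟦_⟧ᶠ : ∀ {bs b} → Fun bs b → All ⟦_⟧ᵇ bs → ⟦ b ⟧ᵇ

    ⟦tt⟧           : ⟦ ttᶜ ⟧ᶜ ≡ true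
    ⟦ff⟧           : ⟦ ffᶜ ⟧ᶜ ≡ false
    ⟦0⟧            : ⟦ 0ᶜ ⟧ᶜ ≡ 0ᴿ
    ⟦⟧ᶜ-injective  : ∀ {b} → Injective _≡_ _≡_ (⟦_⟧ᶜ {b})
    nonzero        : ∃ λ (c : Con rew) → ⟦ c ⟧ᶜ ≢ 0ᴿ

    ⟦plus⟧ : ∀ r s → ⟦ plusᶠ ⟧ᶠ (r ∷ s ∷ []) ≡ r +ᴿ s
    ⟦mix⟧  : ∀ p r s → ⟦ mixᶠ p ⟧ᶠ (r ∷ s ∷ []) ≡ r +[ p ] s
    ⟦leq⟧  : ∀ r s → ⟦ leqᶠ ⟧ᶠ (r ∷ s ∷ []) ≡ ⌊ r ≤ᴿ? s ⌋
    ⟦val⟧  : ∀ {bs b} (f : Fun bs b) (cs : All Con bs) →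
             ⟦ f ⟧ᶠ (All.map ⟦_⟧ᶜ cs) ≡ ⟦ val f cs ⟧ᶜ

-- Terms are intrinsically typed with de Bruijn variables, so typing is
-- part of the syntax and α-equivalence is equality.

module Syntax (𝓡 : Reals) (𝓢 : Signature 𝓡) where
  open Probability 𝓡
  open Signature 𝓢

  infixr 7 _⇒_
  infixr 8 _⊗_
  data Ty : Set where
    base    : Base Other → Ty
    unit    : Ty
    _⊗_ _⇒_ : Ty → Ty → Ty

  Cxt : Set
  Cxt = List Ty

  infix  4 _⊢_
  infixl 7 _∙_
  infix  6 _or_ _·_ _⊕[_]_
  data _⊢_ (Γ : Cxt) : Ty → Set where
    var    : ∀ {σ} → σ ∈ Γ → Γ ⊢ σ
    con    : ∀ {b} → Con b → Γ ⊢ base b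
    fun    : ∀ {bs b} → Fun bs b → All (λ b′ → Γ ⊢ base b′) bs → Γ ⊢ base b
    ite    : ∀ {σ} → Γ ⊢ base bool → Γ ⊢ σ → Γ ⊢ σ → Γ ⊢ σ
    _or_   : ∀ {σ} → Γ ⊢ σ → Γ ⊢ σ → Γ ⊢ σ
    _·_    : ∀ {σ} → Γ ⊢ base rew → Γ ⊢ σ → Γ ⊢ σ
    _⊕[_]_ : ∀ {σ} → Γ ⊢ σ → Prob → Γ ⊢ σ → Γ ⊢ σ
    ⋆      : Γ ⊢ unit
    ⟨_,_⟩  : ∀ {σ τ} → Γ ⊢ σ → Γ ⊢ τ → Γ ⊢ σ ⊗ τ
    fst    : ∀ {σ τ} → Γ ⊢ σ ⊗ τ → Γ ⊢ σ
    snd    : ∀ {σ τ} → Γ ⊢ σ ⊗ τ → Γ ⊢ τ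
    lam    : ∀ {σ τ} → σ ∷ Γ ⊢ τ → Γ ⊢ σ ⇒ τ
    _∙_    : ∀ {σ τ} → Γ ⊢ σ ⇒ τ → Γ ⊢ σ → Γ ⊢ τ

  Args : Cxt → List (Base Other) → Set
  Args Γ = All (λ b → Γ ⊢ base b)

  Program : Ty → Set
  Program σ = [] ⊢ σ

  Ren Sub : Cxt → Cxt → Set
  Ren Γ Δ = ∀ {σ} → σ ∈ Γ → σ ∈ Δ
  Sub Γ Δ = ∀ {σ} → σ ∈ Γ → Δ ⊢ σ

  ext : ∀ {Γ Δ τ} → Ren Γ Δ → Ren (τ ∷ Γ) (τ ∷ Δ)
  ext ρ (here e)  = here e
  ext ρ (there x) = there (ρ x)

  rename  : ∀ {Γ Δ σ} → Ren Γ Δ → Γ ⊢ σ → Δ ⊢ σ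
  rename* : ∀ {Γ Δ bs} → Ren Γ Δ → Args Γ bs → Args Δ bs
  rename ρ (var x)        = var (ρ x)
  rename ρ (con c)        = con c
  rename ρ (fun f Ms)     = fun f (rename* ρ Ms)
  rename ρ (ite L M N)    = ite (rename ρ L) (rename ρ M) (rename ρ N)
  rename ρ (M or N)       = rename ρ M or rename ρ N
  rename ρ (N · M)        = rename ρ N · rename ρ M
  rename ρ (M ⊕[ p ] N)   = rename ρ M ⊕[ p ] rename ρ N
  rename ρ ⋆              = ⋆
  rename ρ ⟨ M , N ⟩      = ⟨ rename ρ M , rename ρ N ⟩
  rename ρ (fst M)        = fst (rename ρ M)
  rename ρ (snd M)        = snd (rename ρ M)
  rename ρ (lam M)        = lam (rename (ext ρ) M)
  rename ρ (M ∙ N)        = rename ρ M ∙ rename ρ N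
  rename* ρ []            = []
  rename* ρ (M ∷ Ms)      = rename ρ M ∷ rename* ρ Ms

  exts : ∀ {Γ Δ τ} → Sub Γ Δ → Sub (τ ∷ Γ) (τ ∷ Δ)
  exts θ (here e)  = var (here e)
  exts θ (there x) = rename there (θ x)

  sub  : ∀ {Γ Δ σ} → Sub Γ Δ → Γ ⊢ σ → Δ ⊢ σ
  sub* : ∀ {Γ Δ bs} → Sub Γ Δ → Args Γ bs → Args Δ bs
  sub θ (var x)        = θ x
  sub θ (con c)        = con c
  sub θ (fun f Ms)     = fun f (sub* θ Ms)
  sub θ (ite L M N)    = ite (sub θ L) (sub θ M) (sub θ N)
  sub θ (M or N)       = sub θ M or sub θ N
  sub θ (N · M)        = sub θ N · sub θ M
  sub θ (M ⊕[ p ] N)   = sub θ M ⊕[ p ] sub θ N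
  sub θ ⋆              = ⋆
  sub θ ⟨ M , N ⟩      = ⟨ sub θ M , sub θ N ⟩
  sub θ (fst M)        = fst (sub θ M)
  sub θ (snd M)        = snd (sub θ M)
  sub θ (lam M)        = lam (sub (exts θ) M)
  sub θ (M ∙ N)        = sub θ M ∙ sub θ N
  sub* θ []            = []
  sub* θ (M ∷ Ms)      = sub θ M ∷ sub* θ Ms

  infixl 5 _,,_
  _,,_ : ∀ {Γ Δ τ} → Sub Γ Δ → Δ ⊢ τ → Sub (τ ∷ Γ) Δ
  (θ ,, N) (here refl) = N
  (θ ,, N) (there x)   = θ x

  infix 9 _[_]
  _[_] : ∀ {Γ σ τ} → σ ∷ Γ ⊢ τ → Γ ⊢ σ → Γ ⊢ τ
  M [ N ] = sub (var ,, N) M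

  data Val : Ty → Set where
    con  : ∀ {b} → Con b → Val (base b)
    ⋆    : Val unit
    pair : ∀ {σ τ} → Val σ → Val τ → Val (σ ⊗ τ)
    lam  : ∀ {σ τ} → σ ∷ [] ⊢ τ → Val (σ ⇒ τ)

  ⌜_⌝ : ∀ {σ} → Val σ → Program σ
  ⌜ con c    ⌝ = con c
  ⌜ ⋆        ⌝ = ⋆
  ⌜ pair V W ⌝ = ⟨ ⌜ V ⌝ , ⌜ W ⌝ ⟩
  ⌜ lam M    ⌝ = lam M

  data EffVal (σ : Ty) : Set where
    leaf   : Val σ → EffVal σ
    _or_   : EffVal σ → EffVal σ → EffVal σ
    _·_    : Con rew → EffVal σ → EffVal σ
    _⊕[_]_ : EffVal σ → Prob → EffVal σ → EffVal σ

  -- Hole σ Γ τ: one-hole contexts C with Γ ⊢ C[L] : τ for closed L : σ.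
  -- The hole may lie under binders; as L is closed, nothing is captured.

  mutual
    data Hole (σ : Ty) (Γ : Cxt) : Ty → Set where
      □     : Hole σ Γ σ
      fun   : ∀ {bs b} → Fun bs b → Hole* σ Γ bs → Hole σ Γ (base b)
      ite₁  : ∀ {τ} → Hole σ Γ (base bool) → Γ ⊢ τ → Γ ⊢ τ → Hole σ Γ τ
      ite₂  : ∀ {τ} → Γ ⊢ base bool → Hole σ Γ τ → Γ ⊢ τ → Hole σ Γ τ
      ite₃  : ∀ {τ} → Γ ⊢ base bool → Γ ⊢ τ → Hole σ Γ τ → Hole σ Γ τ
      or₁   : ∀ {τ} → Hole σ Γ τ → Γ ⊢ τ → Hole σ Γ τ
      or₂   : ∀ {τ} → Γ ⊢ τ → Hole σ Γ τ → Hole σ Γ τ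
      rew₁  : ∀ {τ} → Hole σ Γ (base rew) → Γ ⊢ τ → Hole σ Γ τ
      rew₂  : ∀ {τ} → Γ ⊢ base rew → Hole σ Γ τ → Hole σ Γ τ
      mix₁  : ∀ {τ} → Hole σ Γ τ → Prob → Γ ⊢ τ → Hole σ Γ τ
      mix₂  : ∀ {τ} → Γ ⊢ τ → Prob → Hole σ Γ τ → Hole σ Γ τ
      pair₁ : ∀ {τ υ} → Hole σ Γ τ → Γ ⊢ υ → Hole σ Γ (τ ⊗ υ)
      pair₂ : ∀ {τ υ} → Γ ⊢ τ → Hole σ Γ υ → Hole σ Γ (τ ⊗ υ)
      fst   : ∀ {τ υ} → Hole σ Γ (τ ⊗ υ) → Hole σ Γ τ
      snd   : ∀ {τ υ} → Hole σ Γ (τ ⊗ υ) → Hole σ Γ υ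
      lam   : ∀ {τ υ} → Hole σ (τ ∷ Γ) υ → Hole σ Γ (τ ⇒ υ)
      app₁  : ∀ {τ υ} → Hole σ Γ (τ ⇒ υ) → Γ ⊢ τ → Hole σ Γ υ
      app₂  : ∀ {τ υ} → Γ ⊢ τ ⇒ υ → Hole σ Γ τ → Hole σ Γ υ

    data Hole* (σ : Ty) (Γ : Cxt) : List (Base Other) → Set where
      here  : ∀ {b bs} → Hole σ Γ (base b) → Args Γ bs → Hole* σ Γ (b ∷ bs)
      there : ∀ {b bs} → Γ ⊢ base b → Hole* σ Γ bs → Hole* σ Γ (b ∷ bs)

  fill  : ∀ {σ Γ τ} → Hole σ Γ τ → Program σ → Γ ⊢ τ
  fill* : ∀ {σ Γ bs} → Hole* σ Γ bs → Program σ → Args Γ bs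
  fill □            L = rename (λ ()) L
  fill (fun f C)    L = fun f (fill* C L)
  fill (ite₁ C M N) L = ite (fill C L) M N
  fill (ite₂ M C N) L = ite M (fill C L) N
  fill (ite₃ M N C) L = ite M N (fill C L)
  fill (or₁ C N)    L = fill C L or N
  fill (or₂ M C)    L = M or fill C L
  fill (rew₁ C M)   L = fill C L · M
  fill (rew₂ N C)   L = N · fill C L
  fill (mix₁ C p N) L = fill C L ⊕[ p ] N
  fill (mix₂ M p C) L = M ⊕[ p ] fill C L
  fill (pair₁ C N)  L = ⟨ fill C L , N ⟩
  fill (pair₂ M C)  L = ⟨ M , fill C L ⟩
  fill (fst C)      L = fst (fill C L)
  fill (snd C)      L = snd (fill C L)
  fill (lam C)      L = lam (fill C L)
  fill (app₁ C N)   L = fill C L ∙ N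
  fill (app₂ M C)   L = M ∙ fill C L
  fill* (here C Ms) L = fill C L ∷ Ms
  fill* (there M C) L = M ∷ fill* C L

module Evaluation (𝓡 : Reals) (𝓢 : Signature 𝓡) where
  open Probability 𝓡
  open Signature 𝓢
  open Syntax 𝓡 𝓢

  mutual
    data ECxt (σ : Ty) : Ty → Set where
      □     : ECxt σ σ
      fun   : ∀ {bs b} → Fun bs b → ECxt* σ bs → ECxt σ (base b)
      ite   : ∀ {τ} → ECxt σ (base bool) → Program τ → Program τ → ECxt σ τ
      _·_   : ∀ {τ} → ECxt σ (base rew) → Program τ → ECxt σ τ
      pair₁ : ∀ {τ υ} → ECxt σ τ → Program υ → ECxt σ (τ ⊗ υ)
      pair₂ : ∀ {τ υ} → Val τ → ECxt σ υ → ECxt σ (τ ⊗ υ)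
      fst   : ∀ {τ υ} → ECxt σ (τ ⊗ υ) → ECxt σ τ
      snd   : ∀ {τ υ} → ECxt σ (τ ⊗ υ) → ECxt σ υ
      app₁  : ∀ {τ υ} → ECxt σ (τ ⇒ υ) → Program τ → ECxt σ υ
      app₂  : ∀ {τ υ} → τ ∷ [] ⊢ υ → ECxt σ τ → ECxt σ υ

    data ECxt* (σ : Ty) : List (Base Other) → Set where
      here  : ∀ {b bs} → ECxt σ (base b) → Args [] bs → ECxt* σ (b ∷ bs)
      there : ∀ {b bs} → Con b → ECxt* σ bs → ECxt* σ (b ∷ bs)

  plug  : ∀ {σ τ} → ECxt σ τ → Program σ → Program τ
  plug* : ∀ {σ bs} → ECxt* σ bs → Program σ → Args [] bs
  plug □            L = L
  plug (fun f 𝓔)    L = fun f (plug* 𝓔 L)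
  plug (ite 𝓔 M N)  L = ite (plug 𝓔 L) M N
  plug (𝓔 · M)      L = plug 𝓔 L · M
  plug (pair₁ 𝓔 N)  L = ⟨ plug 𝓔 L , N ⟩
  plug (pair₂ V 𝓔)  L = ⟨ ⌜ V ⌝ , plug 𝓔 L ⟩
  plug (fst 𝓔)      L = fst (plug 𝓔 L)
  plug (snd 𝓔)      L = snd (plug 𝓔 L)
  plug (app₁ 𝓔 N)   L = plug 𝓔 L ∙ N
  plug (app₂ M 𝓔)   L = lam M ∙ plug 𝓔 L
  plug* (here 𝓔 Ms) L = plug 𝓔 L ∷ Ms
  plug* (there c 𝓔) L = con c ∷ plug* 𝓔 L

  infix 3 _↦_ _⟶_ _⇓_
  data _↦_ : ∀ {σ} → Program σ → Program σ → Set where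
    fun : ∀ {bs b} {f : Fun bs b} {cs : All Con bs} → fun f (All.map con cs) ↦ con (val f cs)
    tt  : ∀ {σ} {M N : Program σ} → ite (con ttᶜ) M N ↦ M
    ff  : ∀ {σ} {M N : Program σ} → ite (con ffᶜ) M N ↦ N
    fst : ∀ {σ τ} {V : Val σ} {W : Val τ} → fst ⟨ ⌜ V ⌝ , ⌜ W ⌝ ⟩ ↦ ⌜ V ⌝
    snd : ∀ {σ τ} {V : Val σ} {W : Val τ} → snd ⟨ ⌜ V ⌝ , ⌜ W ⌝ ⟩ ↦ ⌜ W ⌝
    β   : ∀ {σ τ} {M : σ ∷ [] ⊢ τ} {V : Val σ} → lam M ∙ ⌜ V ⌝ ↦ M [ ⌜ V ⌝ ]

  data _⟶_ {τ} : Program τ → Program τ → Set where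
    ξ : ∀ {σ} (𝓔 : ECxt σ τ) {Q Q′} → Q ↦ Q′ → plug 𝓔 Q ⟶ plug 𝓔 Q′

  -- M ⇓ E is the graph of the function Op, generated by its defining
  -- equations.
  data _⇓_ {τ} : Program τ → EffVal τ → Set where
    return : ∀ V → ⌜ V ⌝ ⇓ leaf V
    step   : ∀ {M M′ E} → M ⟶ M′ → M′ ⇓ E → M ⇓ E
    choose : ∀ {σ} (𝓔 : ECxt σ τ) {M₁ M₂ E₁ E₂} →
            plug 𝓔 M₁ ⇓ E₁ → plug 𝓔 M₂ ⇓ E₂ → plug 𝓔 (M₁ or M₂) ⇓ E₁ or E₂
    mix    : ∀ {σ} (𝓔 : ECxt σ τ) {p M₁ M₂ E₁ E₂} →
            plug 𝓔 M₁ ⇓ E₁ → plug 𝓔 M₂ ⇓ E₂ → plug 𝓔 (M₁ ⊕[ p ] M₂) ⇓ E₁ ⊕[ p ] E₂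
    rew    : ∀ {σ} (𝓔 : ECxt σ τ) {c M₁ E} →
            plug 𝓔 M₁ ⇓ E → plug 𝓔 (con c · M₁) ⇓ c · E

module Substitution (𝓡 : Reals) (𝓢 : Signature 𝓡) where
  open Signature 𝓢
  open Syntax 𝓡 𝓢

  cong₃ : ∀ {A B C D : Set} (f : A → B → C → D) {a a′ b b′ c c′} →
          a ≡ a′ → b ≡ b′ → c ≡ c′ → f a b c ≡ f a′ b′ c′
  cong₃ f refl refl refl = refl

  ren-ren  : ∀ {Γ Δ Θ σ} {ρ₁ : Ren Γ Δ} {ρ₂ : Ren Δ Θ} {ρ₃ : Ren Γ Θ} →
    (∀ {σ} (x : σ ∈ Γ) → ρ₂ (ρ₁ x) ≡ ρ₃ x) → (M : Γ ⊢ σ) → rename ρ₂ (rename ρ₁ M) ≡ rename ρ₃ M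
  ren-ren* : ∀ {Γ Δ Θ bs} {ρ₁ : Ren Γ Δ} {ρ₂ : Ren Δ Θ} {ρ₃ : Ren Γ Θ} →
    (∀ {σ} (x : σ ∈ Γ) → ρ₂ (ρ₁ x) ≡ ρ₃ x) → (Ms : Args Γ bs) → rename* ρ₂ (rename* ρ₁ Ms) ≡ rename* ρ₃ Ms
  ren-ren h (var x) = cong var (h x)
  ren-ren h (con c) = refl
  ren-ren h (fun f Ms) = cong (fun f) (ren-ren* h Ms)
  ren-ren h (ite L M N) = cong₃ ite (ren-ren h L) (ren-ren h M) (ren-ren h N)
  ren-ren h (M or N) = cong₂ _or_ (ren-ren h M) (ren-ren h N)
  ren-ren h (N · M) = cong₂ _·_ (ren-ren h N) (ren-ren h M)
  ren-ren h (M ⊕[ p ] N) = cong₂ _⊕[ p ]_ (ren-ren h M) (ren-ren h N)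
  ren-ren h ⋆ = refl
  ren-ren h ⟨ M , N ⟩ = cong₂ ⟨_,_⟩ (ren-ren h M) (ren-ren h N)
  ren-ren h (fst M) = cong fst (ren-ren h M)
  ren-ren h (snd M) = cong snd (ren-ren h M)
  ren-ren h (lam M) = cong lam (ren-ren (λ { (here e) → refl ; (there x) → cong there (h x) }) M)
  ren-ren h (M ∙ N) = cong₂ _∙_ (ren-ren h M) (ren-ren h N)
  ren-ren* h [] = refl
  ren-ren* h (M ∷ Ms) = cong₂ _∷_ (ren-ren h M) (ren-ren* h Ms)

  sub-ren  : ∀ {Γ Δ Θ σ} {ρ₁ : Ren Γ Δ} {θ₂ : Sub Δ Θ} {θ₃ : Sub Γ Θ} →
    (∀ {σ} (x : σ ∈ Γ) → θ₂ (ρ₁ x) ≡ θ₃ x) → (M : Γ ⊢ σ) → sub θ₂ (rename ρ₁ M) ≡ sub θ₃ M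
  sub-ren* : ∀ {Γ Δ Θ bs} {ρ₁ : Ren Γ Δ} {θ₂ : Sub Δ Θ} {θ₃ : Sub Γ Θ} →
    (∀ {σ} (x : σ ∈ Γ) → θ₂ (ρ₁ x) ≡ θ₃ x) → (Ms : Args Γ bs) → sub* θ₂ (rename* ρ₁ Ms) ≡ sub* θ₃ Ms
  sub-ren h (var x) = h x
  sub-ren h (con c) = refl
  sub-ren h (fun f Ms) = cong (fun f) (sub-ren* h Ms)
  sub-ren h (ite L M N) = cong₃ ite (sub-ren h L) (sub-ren h M) (sub-ren h N)
  sub-ren h (M or N) = cong₂ _or_ (sub-ren h M) (sub-ren h N)
  sub-ren h (N · M) = cong₂ _·_ (sub-ren h N) (sub-ren h M)
  sub-ren h (M ⊕[ p ] N) = cong₂ _⊕[ p ]_ (sub-ren h M) (sub-ren h N)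
  sub-ren h ⋆ = refl
  sub-ren h ⟨ M , N ⟩ = cong₂ ⟨_,_⟩ (sub-ren h M) (sub-ren h N)
  sub-ren h (fst M) = cong fst (sub-ren h M)
  sub-ren h (snd M) = cong snd (sub-ren h M)
  sub-ren h (lam M) = cong lam (sub-ren (λ { (here e) → refl ; (there x) → cong (rename there) (h x) }) M)
  sub-ren h (M ∙ N) = cong₂ _∙_ (sub-ren h M) (sub-ren h N)
  sub-ren* h [] = refl
  sub-ren* h (M ∷ Ms) = cong₂ _∷_ (sub-ren h M) (sub-ren* h Ms)

  ren-sub-ext : ∀ {Γ Δ Θ τ} {θ₁ : Sub Γ Δ} {ρ₂ : Ren Δ Θ} {θ₃ : Sub Γ Θ} →
    (∀ {σ} (x : σ ∈ Γ) → rename ρ₂ (θ₁ x) ≡ θ₃ x) →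
    ∀ {σ} (x : σ ∈ τ ∷ Γ) → rename (ext ρ₂) (exts θ₁ x) ≡ exts θ₃ x
  ren-sub-ext h (here e) = refl
  ren-sub-ext {θ₁ = θ₁} h (there x) =
    trans (ren-ren (λ _ → refl) (θ₁ x))
      (trans (sym (ren-ren (λ _ → refl) (θ₁ x))) (cong (rename there) (h x)))

  ren-sub  : ∀ {Γ Δ Θ σ} {θ₁ : Sub Γ Δ} {ρ₂ : Ren Δ Θ} {θ₃ : Sub Γ Θ} →
    (∀ {σ} (x : σ ∈ Γ) → rename ρ₂ (θ₁ x) ≡ θ₃ x) → (M : Γ ⊢ σ) → rename ρ₂ (sub θ₁ M) ≡ sub θ₃ M
  ren-sub* : ∀ {Γ Δ Θ bs} {θ₁ : Sub Γ Δ} {ρ₂ : Ren Δ Θ} {θ₃ : Sub Γ Θ} →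
    (∀ {σ} (x : σ ∈ Γ) → rename ρ₂ (θ₁ x) ≡ θ₃ x) → (Ms : Args Γ bs) → rename* ρ₂ (sub* θ₁ Ms) ≡ sub* θ₃ Ms
  ren-sub h (var x) = h x
  ren-sub h (con c) = refl
  ren-sub h (fun f Ms) = cong (fun f) (ren-sub* h Ms)
  ren-sub h (ite L M N) = cong₃ ite (ren-sub h L) (ren-sub h M) (ren-sub h N)
  ren-sub h (M or N) = cong₂ _or_ (ren-sub h M) (ren-sub h N)
  ren-sub h (N · M) = cong₂ _·_ (ren-sub h N) (ren-sub h M)
  ren-sub h (M ⊕[ p ] N) = cong₂ _⊕[ p ]_ (ren-sub h M) (ren-sub h N)
  ren-sub h ⋆ = refl
  ren-sub h ⟨ M , N ⟩ = cong₂ ⟨_,_⟩ (ren-sub h M) (ren-sub h N)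
  ren-sub h (fst M) = cong fst (ren-sub h M)
  ren-sub h (snd M) = cong snd (ren-sub h M)
  ren-sub h (lam M) = cong lam (ren-sub (ren-sub-ext h) M)
  ren-sub h (M ∙ N) = cong₂ _∙_ (ren-sub h M) (ren-sub h N)
  ren-sub* h [] = refl
  ren-sub* h (M ∷ Ms) = cong₂ _∷_ (ren-sub h M) (ren-sub* h Ms)

  sub-sub-exts : ∀ {Γ Δ Θ τ} {θ₁ : Sub Γ Δ} {θ₂ : Sub Δ Θ} {θ₃ : Sub Γ Θ} →
    (∀ {σ} (x : σ ∈ Γ) → sub θ₂ (θ₁ x) ≡ θ₃ x) →
    ∀ {σ} (x : σ ∈ τ ∷ Γ) → sub (exts θ₂) (exts θ₁ x) ≡ exts θ₃ x
  sub-sub-exts h (here e) = refl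
  sub-sub-exts {θ₁ = θ₁} h (there x) =
    trans (sub-ren (λ _ → refl) (θ₁ x))
      (trans (sym (ren-sub (λ _ → refl) (θ₁ x))) (cong (rename there) (h x)))

  sub-sub  : ∀ {Γ Δ Θ σ} {θ₁ : Sub Γ Δ} {θ₂ : Sub Δ Θ} {θ₃ : Sub Γ Θ} →
    (∀ {σ} (x : σ ∈ Γ) → sub θ₂ (θ₁ x) ≡ θ₃ x) → (M : Γ ⊢ σ) → sub θ₂ (sub θ₁ M) ≡ sub θ₃ M
  sub-sub* : ∀ {Γ Δ Θ bs} {θ₁ : Sub Γ Δ} {θ₂ : Sub Δ Θ} {θ₃ : Sub Γ Θ} →
    (∀ {σ} (x : σ ∈ Γ) → sub θ₂ (θ₁ x) ≡ θ₃ x) → (Ms : Args Γ bs) → sub* θ₂ (sub* θ₁ Ms) ≡ sub* θ₃ Ms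
  sub-sub h (var x) = h x
  sub-sub h (con c) = refl
  sub-sub h (fun f Ms) = cong (fun f) (sub-sub* h Ms)
  sub-sub h (ite L M N) = cong₃ ite (sub-sub h L) (sub-sub h M) (sub-sub h N)
  sub-sub h (M or N) = cong₂ _or_ (sub-sub h M) (sub-sub h N)
  sub-sub h (N · M) = cong₂ _·_ (sub-sub h N) (sub-sub h M)
  sub-sub h (M ⊕[ p ] N) = cong₂ _⊕[ p ]_ (sub-sub h M) (sub-sub h N)
  sub-sub h ⋆ = refl
  sub-sub h ⟨ M , N ⟩ = cong₂ ⟨_,_⟩ (sub-sub h M) (sub-sub h N)
  sub-sub h (fst M) = cong fst (sub-sub h M)
  sub-sub h (snd M) = cong snd (sub-sub h M)
  sub-sub h (lam M) = cong lam (sub-sub (sub-sub-exts h) M)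
  sub-sub h (M ∙ N) = cong₂ _∙_ (sub-sub h M) (sub-sub h N)
  sub-sub* h [] = refl
  sub-sub* h (M ∷ Ms) = cong₂ _∷_ (sub-sub h M) (sub-sub* h Ms)

  sub-id  : ∀ {Γ σ} {θ : Sub Γ Γ} →
    (∀ {σ} (x : σ ∈ Γ) → θ x ≡ var x) → (M : Γ ⊢ σ) → sub θ M ≡ M
  sub-id* : ∀ {Γ bs} {θ : Sub Γ Γ} →
    (∀ {σ} (x : σ ∈ Γ) → θ x ≡ var x) → (Ms : Args Γ bs) → sub* θ Ms ≡ Ms
  sub-id h (var x) = h x
  sub-id h (con c) = refl
  sub-id h (fun f Ms) = cong (fun f) (sub-id* h Ms)
  sub-id h (ite L M N) = cong₃ ite (sub-id h L) (sub-id h M) (sub-id h N)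
  sub-id h (M or N) = cong₂ _or_ (sub-id h M) (sub-id h N)
  sub-id h (N · M) = cong₂ _·_ (sub-id h N) (sub-id h M)
  sub-id h (M ⊕[ p ] N) = cong₂ _⊕[ p ]_ (sub-id h M) (sub-id h N)
  sub-id h ⋆ = refl
  sub-id h ⟨ M , N ⟩ = cong₂ ⟨_,_⟩ (sub-id h M) (sub-id h N)
  sub-id h (fst M) = cong fst (sub-id h M)
  sub-id h (snd M) = cong snd (sub-id h M)
  sub-id h (lam M) = cong lam (sub-id (λ { (here e) → refl ; (there x) → cong (rename there) (h x) }) M)
  sub-id h (M ∙ N) = cong₂ _∙_ (sub-id h M) (sub-id h N)
  sub-id* h [] = refl
  sub-id* h (M ∷ Ms) = cong₂ _∷_ (sub-id h M) (sub-id* h Ms)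

  sub-exts-[] : ∀ {Γ σ τ} (θ : Sub Γ []) (M : σ ∷ Γ ⊢ τ) (N : Program σ) →
                sub (exts θ) M [ N ] ≡ sub (θ ,, N) M
  sub-exts-[] θ M N = sub-sub pointwise M
    where
    pointwise : ∀ {σ} (x : σ ∈ _) → sub (var ,, N) (exts θ x) ≡ (θ ,, N) x
    pointwise (here refl) = refl
    pointwise (there x)   = trans (sub-ren (λ _ → refl) (θ x)) (sub-id (λ _ → refl) (θ x))

module Termination (𝓡 : Reals) (𝓢 : Signature 𝓡) (𝓦 : RewardStructure 𝓡)
                   (𝓘 : Interpretation 𝓡 𝓢 𝓦) where
  open Signature 𝓢
  open Interpretation 𝓘
  open Syntax 𝓡 𝓢
  open Evaluation 𝓡 𝓢
  open Substitution 𝓡 𝓢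

  boolean : (c : Con bool) → c ≡ ttᶜ ⊎ c ≡ ffᶜ
  boolean c = go ⟦ c ⟧ᶜ refl
    where
    go : (b : Bool) → ⟦ c ⟧ᶜ ≡ b → c ≡ ttᶜ ⊎ c ≡ ffᶜ
    go true  e = inj₁ (⟦⟧ᶜ-injective (trans e (sym ⟦tt⟧)))
    go false e = inj₂ (⟦⟧ᶜ-injective (trans e (sym ⟦ff⟧)))

  infixr 9 _⊙_ _⊙*_
  _⊙_  : ∀ {σ τ υ} → ECxt τ υ → ECxt σ τ → ECxt σ υ
  _⊙*_ : ∀ {σ τ bs} → ECxt* τ bs → ECxt σ τ → ECxt* σ bs
  □ ⊙ 𝓕           = 𝓕
  fun f 𝓔 ⊙ 𝓕     = fun f (𝓔 ⊙* 𝓕)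
  ite 𝓔 M N ⊙ 𝓕   = ite (𝓔 ⊙ 𝓕) M N
  (𝓔 · M) ⊙ 𝓕     = (𝓔 ⊙ 𝓕) · M
  pair₁ 𝓔 N ⊙ 𝓕   = pair₁ (𝓔 ⊙ 𝓕) N
  pair₂ V 𝓔 ⊙ 𝓕   = pair₂ V (𝓔 ⊙ 𝓕)
  fst 𝓔 ⊙ 𝓕       = fst (𝓔 ⊙ 𝓕)
  snd 𝓔 ⊙ 𝓕       = snd (𝓔 ⊙ 𝓕)
  app₁ 𝓔 N ⊙ 𝓕    = app₁ (𝓔 ⊙ 𝓕) N
  app₂ M 𝓔 ⊙ 𝓕    = app₂ M (𝓔 ⊙ 𝓕)
  here 𝓔 Ms ⊙* 𝓕  = here (𝓔 ⊙ 𝓕) Ms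
  there c 𝓔 ⊙* 𝓕  = there c (𝓔 ⊙* 𝓕)

  plug-⊙  : ∀ {σ τ υ} (𝓔 : ECxt τ υ) (𝓕 : ECxt σ τ) (L : Program σ) →
            plug (𝓔 ⊙ 𝓕) L ≡ plug 𝓔 (plug 𝓕 L)
  plug-⊙* : ∀ {σ τ bs} (𝓔 : ECxt* τ bs) (𝓕 : ECxt σ τ) (L : Program σ) →
            plug* (𝓔 ⊙* 𝓕) L ≡ plug* 𝓔 (plug 𝓕 L)
  plug-⊙ □           𝓕 L = refl
  plug-⊙ (fun f 𝓔)   𝓕 L = cong (fun f) (plug-⊙* 𝓔 𝓕 L)
  plug-⊙ (ite 𝓔 M N) 𝓕 L = cong (λ K → ite K M N) (plug-⊙ 𝓔 𝓕 L)
  plug-⊙ (𝓔 · M)     𝓕 L = cong (_· M) (plug-⊙ 𝓔 𝓕 L)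
  plug-⊙ (pair₁ 𝓔 N) 𝓕 L = cong (λ K → ⟨ K , N ⟩) (plug-⊙ 𝓔 𝓕 L)
  plug-⊙ (pair₂ V 𝓔) 𝓕 L = cong (λ K → ⟨ ⌜ V ⌝ , K ⟩) (plug-⊙ 𝓔 𝓕 L)
  plug-⊙ (fst 𝓔)     𝓕 L = cong fst (plug-⊙ 𝓔 𝓕 L)
  plug-⊙ (snd 𝓔)     𝓕 L = cong snd (plug-⊙ 𝓔 𝓕 L)
  plug-⊙ (app₁ 𝓔 N)  𝓕 L = cong (_∙ N) (plug-⊙ 𝓔 𝓕 L)
  plug-⊙ (app₂ M 𝓔)  𝓕 L = cong (lam M ∙_) (plug-⊙ 𝓔 𝓕 L)
  plug-⊙* (here 𝓔 Ms) 𝓕 L = cong (_∷ Ms) (plug-⊙ 𝓔 𝓕 L)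
  plug-⊙* (there c 𝓔) 𝓕 L = cong (con c ∷_) (plug-⊙* 𝓔 𝓕 L)

  Leaves : ∀ {σ} → (Val σ → Set) → EffVal σ → Set
  Leaves P (leaf V)        = P V
  Leaves P (E₁ or E₂)      = Leaves P E₁ × Leaves P E₂
  Leaves P (c · E)         = Leaves P E
  Leaves P (E₁ ⊕[ p ] E₂)  = Leaves P E₁ × Leaves P E₂

  -- Tait's computability predicates, extended to effect values.
  Computes : ∀ {σ} → (Val σ → Set) → Program σ → Set
  Computes P M = ∃ λ E → M ⇓ E × Leaves P E

  Red : ∀ σ → Val σ → Set
  Red (base b)  V          = ⊤
  Red unit      V          = ⊤
  Red (σ ⊗ τ)   (pair V W) = Red σ V × Red τ W
  Red (σ ⇒ τ)   (lam M)    = ∀ V → Red σ V → Computes (Red τ) (M [ ⌜ V ⌝ ])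

  Comp : ∀ {σ} → Program σ → Set
  Comp {σ} = Computes (Red σ)

  ⟶-plug : ∀ {σ τ} (𝓔 : ECxt σ τ) {M M′} → M ⟶ M′ → plug 𝓔 M ⟶ plug 𝓔 M′
  ⟶-plug 𝓔 (ξ 𝓕 {Q} {Q′} r) =
    subst₂ _⟶_ (plug-⊙ 𝓔 𝓕 Q) (plug-⊙ 𝓔 𝓕 Q′) (ξ (𝓔 ⊙ 𝓕) r)

  bind : ∀ {σ τ} {P : Val σ → Set} {Q : Val τ → Set} (𝓔 : ECxt σ τ) {M E} →
         M ⇓ E → Leaves P E → (∀ V → P V → Computes Q (plug 𝓔 ⌜ V ⌝)) → Computes Q (plug 𝓔 M)
  bind 𝓔 (return V) l k = k V l
  bind 𝓔 (step s d) l k with bind 𝓔 d l k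
  ... | E , d′ , l′ = E , step (⟶-plug 𝓔 s) d′ , l′
  bind {Q = Q} 𝓔 (choose 𝓕 {M₁} {M₂} d₁ d₂) (l₁ , l₂) k
    with bind 𝓔 d₁ l₁ k | bind 𝓔 d₂ l₂ k
  ... | E₁ , e₁ , m₁ | E₂ , e₂ , m₂ =
    E₁ or E₂ ,
    subst (_⇓ _) (plug-⊙ 𝓔 𝓕 _)
      (choose (𝓔 ⊙ 𝓕) (subst (_⇓ E₁) (sym (plug-⊙ 𝓔 𝓕 M₁)) e₁) (subst (_⇓ E₂) (sym (plug-⊙ 𝓔 𝓕 M₂)) e₂)) ,
    m₁ , m₂
  bind {Q = Q} 𝓔 (mix 𝓕 {p} {M₁} {M₂} d₁ d₂) (l₁ , l₂) k
    with bind 𝓔 d₁ l₁ k | bind 𝓔 d₂ l₂ k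
  ... | E₁ , e₁ , m₁ | E₂ , e₂ , m₂ =
    E₁ ⊕[ p ] E₂ ,
    subst (_⇓ _) (plug-⊙ 𝓔 𝓕 _)
      (mix (𝓔 ⊙ 𝓕) (subst (_⇓ E₁) (sym (plug-⊙ 𝓔 𝓕 M₁)) e₁) (subst (_⇓ E₂) (sym (plug-⊙ 𝓔 𝓕 M₂)) e₂)) ,
    m₁ , m₂
  bind {Q = Q} 𝓔 (rew 𝓕 {c} {M₁} d) l k with bind 𝓔 d l k
  ... | E , e , m =
    c · E ,
    subst (_⇓ _) (plug-⊙ 𝓔 𝓕 _) (rew (𝓔 ⊙ 𝓕) (subst (_⇓ E) (sym (plug-⊙ 𝓔 𝓕 M₁)) e)) ,
    m

  evalAt : ∀ {σ τ} (𝓔 : ECxt σ τ) {M} → Comp M →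
           (∀ V → Red σ V → Comp (plug 𝓔 ⌜ V ⌝)) → Comp (plug 𝓔 M)
  evalAt 𝓔 (E , d , l) k = bind 𝓔 d l k

  computes-value : ∀ {σ} (V : Val σ) → Red σ V → Comp ⌜ V ⌝
  computes-value V r = leaf V , return V , r

  computes-step : ∀ {σ} {M M′ : Program σ} → M ↦ M′ → Comp M′ → Comp M
  computes-step r (E , d , l) = E , step (ξ □ r) d , l

  -- Initial segments c₁ … cₖ of argument lists, nearest constant last.
  data Prefix (bs : List (Base Other)) : List (Base Other) → Set where
    ε   : Prefix bs bs
    _▸_ : ∀ {b bs′} → Prefix bs (b ∷ bs′) → Con b → Prefix bs bs′

  onTerms : ∀ {bs bs′} → Prefix bs bs′ → Args [] bs′ → Args [] bs
  onTerms ε       Ms = Ms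
  onTerms (P ▸ c) Ms = onTerms P (con c ∷ Ms)

  onCons : ∀ {bs bs′} → Prefix bs bs′ → All Con bs′ → All Con bs
  onCons ε       cs = cs
  onCons (P ▸ c) cs = onCons P (c ∷ cs)

  onECxt : ∀ {σ bs bs′} → Prefix bs bs′ → ECxt* σ bs′ → ECxt* σ bs
  onECxt ε       𝓔 = 𝓔
  onECxt (P ▸ c) 𝓔 = onECxt P (there c 𝓔)

  onECxt-plug : ∀ {σ bs bs′} (P : Prefix bs bs′) (𝓔 : ECxt* σ bs′) (L : Program σ) →
                plug* (onECxt P 𝓔) L ≡ onTerms P (plug* 𝓔 L)
  onECxt-plug ε       𝓔 L = refl
  onECxt-plug (P ▸ c) 𝓔 L = onECxt-plug P (there c 𝓔) L

  onCons-con : ∀ {bs bs′} (P : Prefix bs bs′) (cs : All Con bs′) →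
               All.map con (onCons P cs) ≡ onTerms P (All.map con cs)
  onCons-con ε       cs = refl
  onCons-con (P ▸ c) cs = onCons-con P (c ∷ cs)

  computes-fun : ∀ {bs bs′ b} (f : Fun bs b) (P : Prefix bs bs′)
                 (Ms : All (λ b′ → Σ (Program (base b′)) Comp) bs′) →
                 Comp (fun f (onTerms P (All.map proj₁ Ms)))
  computes-fun f P [] =
    subst (λ Ns → Comp (fun f Ns)) (onCons-con P [])
          (computes-step fun (computes-value (con (val f (onCons P []))) tt))
  computes-fun f P ((M , m) ∷ Ms) =
    subst (λ Ns → Comp (fun f Ns)) (onECxt-plug P 𝓔 M)
      (evalAt (fun f (onECxt P 𝓔)) m
        (λ { (con c) _ → subst (λ Ns → Comp (fun f Ns)) (sym (onECxt-plug P 𝓔 (con c)))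
                               (computes-fun f (P ▸ c) Ms) }))
    where 𝓔 = here □ (All.map proj₁ Ms)

  Env : Cxt → Set
  Env Γ = ∀ {σ} → σ ∈ Γ → Σ (Val σ) (Red σ)

  ⌈_⌉ : ∀ {Γ} → Env Γ → Sub Γ []
  ⌈ ρ ⌉ x = ⌜ proj₁ (ρ x) ⌝

  extend : ∀ {Γ σ} → Env Γ → (V : Val σ) → Red σ V → Env (σ ∷ Γ)
  extend ρ V r (here refl) = V , r
  extend ρ V r (there x)   = ρ x

  fundamental  : ∀ {Γ σ} (ρ : Env Γ) (M : Γ ⊢ σ) → Comp (sub ⌈ ρ ⌉ M)
  fundamental* : ∀ {Γ bs} (ρ : Env Γ) (Ms : Args Γ bs) →
                 Σ (All (λ b → Σ (Program (base b)) Comp) bs) λ Ns → All.map proj₁ Ns ≡ sub* ⌈ ρ ⌉ Ms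
  fundamental ρ (var x) = computes-value (proj₁ (ρ x)) (proj₂ (ρ x))
  fundamental ρ (con c) = computes-value (con c) tt
  fundamental ρ (fun f Ms) with fundamental* ρ Ms
  ... | Ns , e = subst (λ Ns → Comp (fun f Ns)) e (computes-fun f ε Ns)
  fundamental ρ (ite L M N) =
    evalAt (ite □ _ _) (fundamental ρ L) (λ { (con c) _ → branch c (boolean c) })
    where
    branch : ∀ c → c ≡ ttᶜ ⊎ c ≡ ffᶜ → Comp (ite (con c) (sub ⌈ ρ ⌉ M) (sub ⌈ ρ ⌉ N))
    branch c (inj₁ refl) = computes-step tt (fundamental ρ M)
    branch c (inj₂ refl) = computes-step ff (fundamental ρ N)
  fundamental ρ (M or N) with fundamental ρ M | fundamental ρ N
  ... | E₁ , d₁ , l₁ | E₂ , d₂ , l₂ = E₁ or E₂ , choose □ d₁ d₂ , l₁ , l₂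
  fundamental ρ (N · M) =
    evalAt (□ · _) (fundamental ρ N) (λ { (con c) _ → emit c (fundamental ρ M) })
    where
    emit : ∀ c → Comp (sub ⌈ ρ ⌉ M) → Comp (con c · sub ⌈ ρ ⌉ M)
    emit c (E , d , l) = c · E , rew □ d , l
  fundamental ρ (M ⊕[ p ] N) with fundamental ρ M | fundamental ρ N
  ... | E₁ , d₁ , l₁ | E₂ , d₂ , l₂ = E₁ ⊕[ p ] E₂ , mix □ d₁ d₂ , l₁ , l₂
  fundamental ρ ⋆ = computes-value ⋆ tt
  fundamental ρ ⟨ M , N ⟩ =
    evalAt (pair₁ □ _) (fundamental ρ M) λ V r →
    evalAt (pair₂ V □) (fundamental ρ N) λ W s →
    computes-value (pair V W) (r , s)
  fundamental ρ (fst M) =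
    evalAt (fst □) (fundamental ρ M) λ { (pair V W) (r , _) → computes-step fst (computes-value V r) }
  fundamental ρ (snd M) =
    evalAt (snd □) (fundamental ρ M) λ { (pair V W) (_ , s) → computes-step snd (computes-value W s) }
  fundamental {σ = σ ⇒ τ} ρ (lam M) = computes-value (lam _) λ V r →
    subst Comp (trans (sub-cong V r) (sym (sub-exts-[] ⌈ ρ ⌉ M ⌜ V ⌝))) (fundamental (extend ρ V r) M)
    where
    sub-cong : ∀ V r → sub ⌈ extend ρ V r ⌉ M ≡ sub (⌈ ρ ⌉ ,, ⌜ V ⌝) M
    sub-cong V r =
      trans (cong (sub _) (sym (sub-id (λ _ → refl) M)))
            (sub-sub (λ { (here refl) → refl ; (there x) → refl }) M)
  fundamental ρ (M ∙ N) =
    evalAt (app₁ □ _) (fundamental ρ M) λ { (lam K) k →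
    evalAt (app₂ K □) (fundamental ρ N) λ V r →
    computes-step β (k V r) }
  fundamental* ρ [] = [] , refl
  fundamental* ρ (M ∷ Ms) with fundamental* ρ Ms
  ... | Ns , e = (_ , fundamental ρ M) ∷ Ns , cong (_ ∷_) e

  terminates : ∀ {σ} (M : Program σ) → ∃ (M ⇓_)
  terminates M with fundamental {[]} (λ ()) M
  ... | E , d , _ = E , subst (_⇓ E) (sub-id (λ ()) M) d

  -- The unique E with M ⇓ E (uniqueness is ⇓-deterministic below).
  Op : ∀ {σ} → Program σ → EffVal σ
  Op M = proj₁ (terminates M)

module Determinism (𝓡 : Reals) (𝓢 : Signature 𝓡) (𝓦 : RewardStructure 𝓡)
                   (𝓘 : Interpretation 𝓡 𝓢 𝓦) where
  open Probability 𝓡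
  open Signature 𝓢
  open Interpretation 𝓘
  open Syntax 𝓡 𝓢
  open Evaluation 𝓡 𝓢

  data Active : Ty → Set where
    fun    : ∀ {bs b} → Fun bs b → All Con bs → Active (base b)
    ite    : ∀ {σ} → Con bool → Program σ → Program σ → Active σ
    _or_   : ∀ {σ} → Program σ → Program σ → Active σ
    _·_    : ∀ {σ} → Con rew → Program σ → Active σ
    _⊕[_]_ : ∀ {σ} → Program σ → Prob → Program σ → Active σ
    fst    : ∀ {σ τ} → Val σ → Val τ → Active σ
    snd    : ∀ {σ τ} → Val σ → Val τ → Active τ
    app    : ∀ {σ τ} → σ ∷ [] ⊢ τ → Val σ → Active τ

  ⌊_⌋ᴬ : ∀ {σ} → Active σ → Program σ
  ⌊ fun f cs ⌋ᴬ     = fun f (All.map con cs)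
  ⌊ ite c M N ⌋ᴬ    = ite (con c) M N
  ⌊ M or N ⌋ᴬ       = M or N
  ⌊ c · M ⌋ᴬ        = con c · M
  ⌊ M ⊕[ p ] N ⌋ᴬ   = M ⊕[ p ] N
  ⌊ fst V W ⌋ᴬ      = fst ⟨ ⌜ V ⌝ , ⌜ W ⌝ ⟩
  ⌊ snd V W ⌋ᴬ      = snd ⟨ ⌜ V ⌝ , ⌜ W ⌝ ⟩
  ⌊ app M V ⌋ᴬ      = lam M ∙ ⌜ V ⌝

  Decomp : Ty → Set
  Decomp τ = Val τ ⊎ ∃ λ σ → ECxt σ τ × Active σ

  Decomp* : List (Base Other) → Set
  Decomp* bs = All Con bs ⊎ ∃ λ σ → ECxt* σ bs × Active σ

  pattern active 𝓔 A = inj₂ (_ , 𝓔 , A)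

  d-fun : ∀ {bs b} → Fun bs b → Decomp* bs → Decomp (base b)
  d-fun f (inj₁ cs)    = active □ (fun f cs)
  d-fun f (active 𝓔 A) = active (fun f 𝓔) A

  d-ite : ∀ {σ} → Program σ → Program σ → Decomp (base bool) → Decomp σ
  d-ite M N (inj₁ (con c)) = active □ (ite c M N)
  d-ite M N (active 𝓔 A)   = active (ite 𝓔 M N) A

  d-rew : ∀ {σ} → Program σ → Decomp (base rew) → Decomp σ
  d-rew M (inj₁ (con c)) = active □ (c · M)
  d-rew M (active 𝓔 A)   = active (𝓔 · M) A

  d-pair : ∀ {σ τ} → Program τ → Decomp σ → Decomp τ → Decomp (σ ⊗ τ)
  d-pair N (active 𝓔 A) _            = active (pair₁ 𝓔 N) A
  d-pair N (inj₁ V)     (active 𝓔 A) = active (pair₂ V 𝓔) A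
  d-pair N (inj₁ V)     (inj₁ W)     = inj₁ (pair V W)

  d-fst : ∀ {σ τ} → Decomp (σ ⊗ τ) → Decomp σ
  d-fst (inj₁ (pair V W)) = active □ (fst V W)
  d-fst (active 𝓔 A)      = active (fst 𝓔) A

  d-snd : ∀ {σ τ} → Decomp (σ ⊗ τ) → Decomp τ
  d-snd (inj₁ (pair V W)) = active □ (snd V W)
  d-snd (active 𝓔 A)      = active (snd 𝓔) A

  d-app : ∀ {σ τ} → Program σ → Decomp (σ ⇒ τ) → Decomp σ → Decomp τ
  d-app N (active 𝓔 A)   _            = active (app₁ 𝓔 N) A
  d-app N (inj₁ (lam M)) (active 𝓔 A) = active (app₂ M 𝓔) A
  d-app N (inj₁ (lam M)) (inj₁ V)     = active □ (app M V)

  d-∷ : ∀ {b bs} → Args [] bs → Decomp (base b) → Decomp* bs → Decomp* (b ∷ bs)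
  d-∷ Ms (active 𝓔 A)   _            = active (here 𝓔 Ms) A
  d-∷ Ms (inj₁ (con c)) (active 𝓔 A) = active (there c 𝓔) A
  d-∷ Ms (inj₁ (con c)) (inj₁ cs)    = inj₁ (c ∷ cs)

  decompose  : ∀ {σ} → Program σ → Decomp σ
  decompose* : ∀ {bs} → Args [] bs → Decomp* bs
  decompose (con c)       = inj₁ (con c)
  decompose (fun f Ms)    = d-fun f (decompose* Ms)
  decompose (ite L M N)   = d-ite M N (decompose L)
  decompose (M or N)      = active □ (M or N)
  decompose (N · M)       = d-rew M (decompose N)
  decompose (M ⊕[ p ] N)  = active □ (M ⊕[ p ] N)
  decompose ⋆             = inj₁ ⋆
  decompose ⟨ M , N ⟩     = d-pair N (decompose M) (decompose N)
  decompose (fst M)       = d-fst (decompose M)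
  decompose (snd M)       = d-snd (decompose M)
  decompose (lam M)       = inj₁ (lam M)
  decompose (M ∙ N)       = d-app N (decompose M) (decompose N)
  decompose* []           = inj₁ []
  decompose* (M ∷ Ms)     = d-∷ Ms (decompose M) (decompose* Ms)

  decompose-value : ∀ {σ} (V : Val σ) → decompose ⌜ V ⌝ ≡ inj₁ V
  decompose-value (con c)    = refl
  decompose-value ⋆          = refl
  decompose-value (pair V W) = cong₂ (d-pair ⌜ W ⌝) (decompose-value V) (decompose-value W)
  decompose-value (lam M)    = refl

  decompose-cons : ∀ {bs} (cs : All Con bs) → decompose* (All.map con cs) ≡ inj₁ cs
  decompose-cons []       = refl
  decompose-cons (c ∷ cs) = cong (d-∷ _ _) (decompose-cons cs)

  decompose-active : ∀ {σ} (A : Active σ) → decompose ⌊ A ⌋ᴬ ≡ active □ A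
  decompose-active (fun f cs)    = cong (d-fun f) (decompose-cons cs)
  decompose-active (ite c M N)   = refl
  decompose-active (M or N)      = refl
  decompose-active (c · M)       = refl
  decompose-active (M ⊕[ p ] N)  = refl
  decompose-active (fst V W)     = cong d-fst (decompose-value (pair V W))
  decompose-active (snd V W)     = cong d-snd (decompose-value (pair V W))
  decompose-active (app M V)     = cong (d-app _ _) (decompose-value V)

  decompose-plug  : ∀ {σ τ} (𝓔 : ECxt σ τ) (A : Active σ) →
                    decompose (plug 𝓔 ⌊ A ⌋ᴬ) ≡ active 𝓔 A
  decompose-plug* : ∀ {σ bs} (𝓔 : ECxt* σ bs) (A : Active σ) →
                    decompose* (plug* 𝓔 ⌊ A ⌋ᴬ) ≡ active 𝓔 A
  decompose-plug □            A = decompose-active A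
  decompose-plug (fun f 𝓔)    A = cong (d-fun f) (decompose-plug* 𝓔 A)
  decompose-plug (ite 𝓔 M N)  A = cong (d-ite M N) (decompose-plug 𝓔 A)
  decompose-plug (𝓔 · M)      A = cong (d-rew M) (decompose-plug 𝓔 A)
  decompose-plug (pair₁ 𝓔 N)  A = cong (λ d → d-pair N d (decompose N)) (decompose-plug 𝓔 A)
  decompose-plug (pair₂ V 𝓔)  A = cong₂ (d-pair _) (decompose-value V) (decompose-plug 𝓔 A)
  decompose-plug (fst 𝓔)      A = cong d-fst (decompose-plug 𝓔 A)
  decompose-plug (snd 𝓔)      A = cong d-snd (decompose-plug 𝓔 A)
  decompose-plug (app₁ 𝓔 N)   A = cong (λ d → d-app N d (decompose N)) (decompose-plug 𝓔 A)
  decompose-plug (app₂ M 𝓔)   A = cong (d-app _ _) (decompose-plug 𝓔 A)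
  decompose-plug* (here 𝓔 Ms) A = cong (λ d → d-∷ Ms d (decompose* Ms)) (decompose-plug 𝓔 A)
  decompose-plug* (there c 𝓔) A = cong (d-∷ _ _) (decompose-plug* 𝓔 A)

  Contracts : ∀ {σ} → Active σ → Program σ → Set
  Contracts (fun f cs)    Q = Q ≡ con (val f cs)
  Contracts (ite c M N)   Q = (c ≡ ttᶜ × Q ≡ M) ⊎ (c ≡ ffᶜ × Q ≡ N)
  Contracts (M or N)      Q = ⊥
  Contracts (c · M)       Q = ⊥
  Contracts (M ⊕[ p ] N)  Q = ⊥
  Contracts (fst V W)     Q = Q ≡ ⌜ V ⌝
  Contracts (snd V W)     Q = Q ≡ ⌜ W ⌝
  Contracts (app M V)     Q = Q ≡ M [ ⌜ V ⌝ ]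

  tt≢ff : ttᶜ ≢ ffᶜ
  tt≢ff e with trans (sym ⟦tt⟧) (trans (cong ⟦_⟧ᶜ e) ⟦ff⟧)
  ... | ()

  contracts-unique : ∀ {σ} (A : Active σ) {Q Q′} → Contracts A Q → Contracts A Q′ → Q ≡ Q′
  contracts-unique (fun f cs)  refl refl = refl
  contracts-unique (ite c M N) (inj₁ (_ , refl)) (inj₁ (_ , refl)) = refl
  contracts-unique (ite c M N) (inj₁ (e , _))    (inj₂ (e′ , _))   = ⊥-elim (tt≢ff (trans (sym e) e′))
  contracts-unique (ite c M N) (inj₂ (e , _))    (inj₁ (e′ , _))   = ⊥-elim (tt≢ff (trans (sym e′) e))
  contracts-unique (ite c M N) (inj₂ (_ , refl)) (inj₂ (_ , refl)) = refl
  contracts-unique (fst V W)   refl refl = refl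
  contracts-unique (snd V W)   refl refl = refl
  contracts-unique (app M V)   refl refl = refl

  redex : ∀ {σ} {Q Q′ : Program σ} → Q ↦ Q′ → ∃ λ A → Q ≡ ⌊ A ⌋ᴬ × Contracts A Q′
  redex (fun {f = f} {cs})       = fun f cs , refl , refl
  redex (tt {M = M} {N})         = ite ttᶜ M N , refl , inj₁ (refl , refl)
  redex (ff {M = M} {N})         = ite ffᶜ M N , refl , inj₂ (refl , refl)
  redex (fst {V = V} {W})        = fst V W , refl , refl
  redex (snd {V = V} {W})        = snd V W , refl , refl
  redex (β {M = M} {V})          = app M V , refl , refl

  Result : ∀ {τ} → Decomp τ → EffVal τ → Set
  Result (inj₁ V) E = leaf V ≡ E
  Result (active 𝓔 (M or N)) E =
    ∃ λ E₁ → ∃ λ E₂ → plug 𝓔 M ⇓ E₁ × plug 𝓔 N ⇓ E₂ × E₁ or E₂ ≡ E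
  Result (active 𝓔 (M ⊕[ p ] N)) E =
    ∃ λ E₁ → ∃ λ E₂ → plug 𝓔 M ⇓ E₁ × plug 𝓔 N ⇓ E₂ × E₁ ⊕[ p ] E₂ ≡ E
  Result (active 𝓔 (c · M)) E = ∃ λ E₁ → plug 𝓔 M ⇓ E₁ × c · E₁ ≡ E
  Result (active 𝓔 A) E = ∃ λ Q → Contracts A Q × plug 𝓔 Q ⇓ E

  result-step : ∀ {σ τ} (𝓔 : ECxt σ τ) (A : Active σ) {E Q} → Contracts A Q → plug 𝓔 Q ⇓ E →
                Result (active 𝓔 A) E
  result-step 𝓔 (fun f cs)  c d = _ , c , d
  result-step 𝓔 (ite b M N) c d = _ , c , d
  result-step 𝓔 (fst V W)   c d = _ , c , d
  result-step 𝓔 (snd V W)   c d = _ , c , d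
  result-step 𝓔 (app M V)   c d = _ , c , d

  step-result : ∀ {σ τ} (𝓔 : ECxt σ τ) (A : Active σ) {E Q} → Contracts A Q →
                Result (active 𝓔 A) E → plug 𝓔 Q ⇓ E
  step-result 𝓔 A@(fun f cs)  c (_ , c′ , d) = subst (λ Q → plug 𝓔 Q ⇓ _) (contracts-unique A c′ c) d
  step-result 𝓔 A@(ite b M N) c (_ , c′ , d) = subst (λ Q → plug 𝓔 Q ⇓ _) (contracts-unique A c′ c) d
  step-result 𝓔 A@(fst V W)   c (_ , c′ , d) = subst (λ Q → plug 𝓔 Q ⇓ _) (contracts-unique A c′ c) d
  step-result 𝓔 A@(snd V W)   c (_ , c′ , d) = subst (λ Q → plug 𝓔 Q ⇓ _) (contracts-unique A c′ c) d
  step-result 𝓔 A@(app M V)   c (_ , c′ , d) = subst (λ Q → plug 𝓔 Q ⇓ _) (contracts-unique A c′ c) d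

  result : ∀ {τ} {M : Program τ} {E} → M ⇓ E → Result (decompose M) E
  result {E = E} (return V) = subst (λ d → Result d E) (sym (decompose-value V)) refl
  result {E = E} (step (ξ 𝓔 r) d) with redex r
  ... | A , refl , c = subst (λ d → Result d E) (sym (decompose-plug 𝓔 A)) (result-step 𝓔 A c d)
  result {E = E} (choose 𝓔 d₁ d₂) =
    subst (λ d → Result d E) (sym (decompose-plug 𝓔 (_ or _))) (_ , _ , d₁ , d₂ , refl)
  result {E = E} (mix 𝓔 d₁ d₂) =
    subst (λ d → Result d E) (sym (decompose-plug 𝓔 (_ ⊕[ _ ] _))) (_ , _ , d₁ , d₂ , refl)
  result {E = E} (rew 𝓔 d) =
    subst (λ d → Result d E) (sym (decompose-plug 𝓔 (_ · _))) (_ , d , refl)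

  ⇓-deterministic : ∀ {τ} {M : Program τ} {E E′} → M ⇓ E → M ⇓ E′ → E ≡ E′
  ⇓-deterministic {E′ = E′} (return V) e = subst (λ d → Result d E′) (decompose-value V) (result e)
  ⇓-deterministic {E′ = E′} (step (ξ 𝓔 r) d) e with redex r
  ... | A , refl , c =
    ⇓-deterministic d (step-result 𝓔 A c (subst (λ d → Result d E′) (decompose-plug 𝓔 A) (result e)))
  ⇓-deterministic {E′ = E′} (choose 𝓔 {M₁} {M₂} d₁ d₂) e
    with subst (λ d → Result d E′) (decompose-plug 𝓔 (M₁ or M₂)) (result e)
  ... | _ , _ , e₁ , e₂ , refl = cong₂ _or_ (⇓-deterministic d₁ e₁) (⇓-deterministic d₂ e₂)
  ⇓-deterministic {E′ = E′} (mix 𝓔 {p} {M₁} {M₂} d₁ d₂) e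
    with subst (λ d → Result d E′) (decompose-plug 𝓔 (M₁ ⊕[ p ] M₂)) (result e)
  ... | _ , _ , e₁ , e₂ , refl = cong₂ _⊕[ p ]_ (⇓-deterministic d₁ e₁) (⇓-deterministic d₂ e₂)
  ⇓-deterministic {E′ = E′} (rew 𝓔 {c} {M₁} d) e
    with subst (λ d → Result d E′) (decompose-plug 𝓔 (c · M₁)) (result e)
  ... | _ , e₁ , refl = cong (c ·_) (⇓-deterministic d e₁)

module Distributions (𝓡 : Reals) where
  open Reals 𝓡
  open RealProperties 𝓡
  open Probability 𝓡

  total : {X : Set} → List (ℝ × X) → ℝ
  total []            = 0#
  total ((w , _) ∷ l) = w + total l

  Weighted : {X : Set} → ℝ → List (ℝ × X) → Set
  Weighted t l = All (λ wx → 0# ≤ proj₁ wx) l × total l ≡ t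

  -- A formal sum ∑ᵢ wᵢ xᵢ.  Repetitions and zero weights are allowed, so
  -- equality of distributions is equality of mass functions (distSetoid),
  -- not of the underlying lists.
  record Dist (X : Set) : Set where
    constructor dist
    field
      terms     : List (ℝ × X)
      .weighted : Weighted 1# terms
  open Dist public using (terms)

  δ : {X : Set} → X → Dist X
  δ x = dist ((1# , x) ∷ []) (0≤1 ∷ [] , +-identityʳ 1#)

  weights-map : {X Y : Set} → (X → Y) → List (ℝ × X) → List (ℝ × Y)
  weights-map f = map (λ (w , x) → w , f x)

  scale : {X : Set} → ℝ → List (ℝ × X) → List (ℝ × X)
  scale a = map (λ (w , x) → a * w , x)

  weights-map-weighted : {X Y : Set} (f : X → Y) {t : ℝ} (l : List (ℝ × X)) →
                         Weighted t l → Weighted t (weights-map f l)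
  weights-map-weighted f [] (_ , refl) = [] , refl
  weights-map-weighted f (_ ∷ l) (h ∷ hs , refl) with weights-map-weighted f l (hs , refl)
  ... | hs′ , e = h ∷ hs′ , cong (_ +_) e

  scale-weighted : {X : Set} {a t : ℝ} → 0# ≤ a → (l : List (ℝ × X)) →
                   Weighted t l → Weighted (a * t) (scale a l)
  scale-weighted {a = a} ha [] (_ , refl) = [] , sym (zeroʳ a)
  scale-weighted {a = a} ha ((w , _) ∷ l) (h ∷ hs , refl) with scale-weighted ha l (hs , refl)
  ... | hs′ , e = *-nonneg ha h ∷ hs′ , trans (cong (a * w +_) e) (sym (distribˡ a w (total l)))

  ++-weighted : {X : Set} {t u : ℝ} (k l : List (ℝ × X)) →
                Weighted t k → Weighted u l → Weighted (t + u) (k ++ l)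
  ++-weighted [] l (_ , refl) (hs , refl) = hs , sym (+-identityˡ (total l))
  ++-weighted ((w , _) ∷ k) l (h ∷ hs , refl) v with ++-weighted k l (hs , refl) v
  ... | hs′ , e = h ∷ hs′ , trans (cong (w +_) e) (sym (+-assoc w (total k) _))

  mapᴰ : {X Y : Set} → (X → Y) → Dist X → Dist Y
  mapᴰ f (dist l h) = dist (weights-map f l) (weights-map-weighted f l h)

  mixᴰ : {X : Set} → Prob → Dist X → Dist X → Dist X
  mixᴰ (prob p 0≤p p≤1) (dist k h) (dist l h′) =
    dist (scale p k ++ scale (1# - p) l)
         (subst (λ t → Weighted t (scale p k ++ scale (1# - p) l)) sum≡1
           (++-weighted (scale p k) (scale (1# - p) l)
             (scale-weighted 0≤p k h) (scale-weighted (a≤b⇒0≤b-a p≤1) l h′)))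
    where
    sum≡1 : p * 1# + (1# - p) * 1# ≡ 1#
    sum≡1 = trans (cong₂ _+_ (*-identityʳ p) (*-identityʳ (1# - p)))
                  (trans (+-comm p (1# - p)) (a-b+b 1# p))

  mass : {X : Set} → DecidableEquality X → List (ℝ × X) → X → ℝ
  mass _≟ˣ_ []            y = 0#
  mass _≟ˣ_ ((w , x) ∷ l) y = (if ⌊ x ≟ˣ y ⌋ then w else 0#) + mass _≟ˣ_ l y

  distSetoid : (X : Set) → DecidableEquality X → Setoid 0ℓ 0ℓ
  distSetoid X _≟ˣ_ = record
    { Carrier       = Dist X
    ; _≈_           = λ μ ν → ∀ x → mass _≟ˣ_ (terms μ) x ≡ mass _≟ˣ_ (terms ν) x
    ; isEquivalence = record
      { refl  = λ _ → refl
      ; sym   = λ h x → sym (h x)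
      ; trans = λ h k x → trans (h x) (k x)
      }
    }

  total-nonneg : {X : Set} {t : ℝ} (l : List (ℝ × X)) → Weighted t l → 0# ≤ t
  total-nonneg []      (_ , refl)      = ≤-refl
  total-nonneg (_ ∷ l) (h ∷ hs , refl) = +-nonneg h (total-nonneg l (hs , refl))

  weighted-tail : {X : Set} {t w : ℝ} {x : X} {l : List (ℝ × X)} →
                  Weighted t ((w , x) ∷ l) → Weighted (t - w) l
  weighted-tail (_ ∷ hs , e) = hs , a+b≡c⇒b≡c-a e

  head≤total : {X : Set} {t w : ℝ} {x : X} {l : List (ℝ × X)} →
               Weighted t ((w , x) ∷ l) → w ≤ t
  head≤total {l = l} (_ ∷ hs , refl) = a≤a+b (total-nonneg l (hs , refl))

module ConvexCombination (𝓡 : Reals) (𝓦 : RewardStructure 𝓡) where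
  open Reals 𝓡
  open RealProperties 𝓡
  open Probability 𝓡
  open Distributions 𝓡
  open RewardStructure 𝓦

  -- For weights with sum t ≠ 0, the convex combination ∑ᵢ (wᵢ / t) rᵢ,
  -- unfolded as r₁ +[ w₁ / t ] ∑_{i>1} (wᵢ / (t - w₁)) rᵢ; when w₁ = t
  -- the remaining weights vanish.
  convex : (t : ℝ) → .(t ≢ 0#) → (l : List (ℝ × R)) → .(Weighted t l) → R
  convex t t≢0 []            h = ⊥-elim-irr (t≢0 (sym (proj₂ h)))
  convex t t≢0 ((w , r) ∷ l) h with w ≟ t
  ... | yes _  = r
  ... | no w≢t = r +[ ratio w t (All.head (proj₁ h)) (head≤total h) t≢0 ]
                 convex (t - w) (λ e → w≢t (sym (a-b≡0⇒a≡b e))) l (weighted-tail h)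

  ∑ : Dist R → R
  ∑ (dist l h) = convex 1# (λ e → 0≢1 (sym e)) l h

module Selection (𝓡 : Reals) (𝓢 : Signature 𝓡) (𝓦 : RewardStructure 𝓡)
                 (𝓘 : Interpretation 𝓡 𝓢 𝓦) where
  open Probability 𝓡
  open Signature 𝓢
  open RewardStructure 𝓦
  open Interpretation 𝓘
  open Syntax 𝓡 𝓢
  open Distributions 𝓡
  open ConvexCombination 𝓡 𝓦
  open Termination 𝓡 𝓢 𝓦 𝓘 using (Op)

  DW : Set → Set
  DW X = Dist (R × X)

  _⊙ᴿ_ : ∀ {X} → R → DW X → DW X
  r ⊙ᴿ μ = mapᴰ (λ (s , x) → r +ᴿ s , x) μ

  𝐄 : ∀ {X} → DW X → R
  𝐄 μ = ∑ (mapᴰ proj₁ μ)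

  VDis : ∀ {X} → DW X → Dist X
  VDis = mapᴰ proj₂

  Str : ∀ {σ} → EffVal σ → Set
  Str (leaf V)        = ⊤
  Str (E₁ or E₂)      = Str E₁ ⊎ Str E₂
  Str (c · E)         = Str E
  Str (E₁ ⊕[ p ] E₂)  = Str E₁ × Str E₂

  Out : ∀ {σ} (E : EffVal σ) → Str E → DW (Val σ)
  Out (leaf V)       _         = δ (0ᴿ , V)
  Out (E₁ or E₂)     (inj₁ s)  = Out E₁ s
  Out (E₁ or E₂)     (inj₂ s)  = Out E₂ s
  Out (c · E)        s         = ⟦ c ⟧ᶜ ⊙ᴿ Out E s
  Out (E₁ ⊕[ p ] E₂) (s₁ , s₂) = mixᴰ p (Out E₁ s₁) (Out E₂ s₂)

  Rew : ∀ {σ} (E : EffVal σ) → Str E → R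
  Rew E s = 𝐄 (Out E s)

  -- The strict order on strategies; 1s and 2s are inj₁ s and inj₂ s.
  StrLT : ∀ {σ} (E : EffVal σ) → Str E → Str E → Set
  StrLT (leaf V)        = λ _ _ → ⊥
  StrLT (E₁ or E₂)      = StrLT E₁ ⊎-< StrLT E₂
  StrLT (c · E)         = StrLT E
  StrLT (E₁ ⊕[ p ] E₂)  = ×-Lex _≡_ (StrLT E₁) (StrLT E₂)

  StrLE : ∀ {σ} (E : EffVal σ) → Str E → Str E → Set
  StrLE E s t = s ≡ t ⊎ StrLT E s t

  Maximizes : {S : Set} → (S → R) → S → Set
  Maximizes f s = ∀ t → f t ≤ᴿ f s

  LeastMaximizer : ∀ {σ} (E : EffVal σ) → (Str E → R) → Str E → Set
  LeastMaximizer E f s = Maximizes f s × (∀ t → Maximizes f t → StrLE E s t)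

  leastMaximizer : ∀ {σ} (E : EffVal σ) (f : Str E → R) → ∃ (LeastMaximizer E f)
  leastMaximizer (leaf V) f = tt , (λ _ → ≤ᴿ-refl) , λ _ _ → inj₁ refl
  leastMaximizer (E₁ or E₂) f
    with leastMaximizer E₁ (f ∘ inj₁) | leastMaximizer E₂ (f ∘ inj₂)
  ... | s₁ , max₁ , least₁ | s₂ , max₂ , least₂ with f (inj₂ s₂) ≤ᴿ? f (inj₁ s₁)
  ...   | yes 2≤1 = inj₁ s₁ , max , least
    where
    max : Maximizes f (inj₁ s₁)
    max (inj₁ t) = max₁ t
    max (inj₂ t) = ≤ᴿ-trans (max₂ t) 2≤1
    least : ∀ t → Maximizes f t → StrLE (E₁ or E₂) (inj₁ s₁) t
    least (inj₁ t) m with least₁ t (m ∘ inj₁)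
    ... | inj₁ refl = inj₁ refl
    ... | inj₂ lt   = inj₂ (₁∼₁ lt)
    least (inj₂ t) m = inj₂ ₁∼₂
  ...   | no 2≰1 = inj₂ s₂ , max , least
    where
    1≤2 : f (inj₁ s₁) ≤ᴿ f (inj₂ s₂)
    1≤2 with ≤ᴿ-total (f (inj₁ s₁)) (f (inj₂ s₂))
    ... | inj₁ h = h
    ... | inj₂ h = ⊥-elim (2≰1 h)
    max : Maximizes f (inj₂ s₂)
    max (inj₁ t) = ≤ᴿ-trans (max₁ t) 1≤2
    max (inj₂ t) = max₂ t
    least : ∀ t → Maximizes f t → StrLE (E₁ or E₂) (inj₂ s₂) t
    least (inj₁ t) m = ⊥-elim (2≰1 (≤ᴿ-trans (m (inj₂ s₂)) (max₁ t)))
    least (inj₂ t) m with least₂ t (m ∘ inj₂)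
    ... | inj₁ refl = inj₁ refl
    ... | inj₂ lt   = inj₂ (₂∼₂ lt)
  leastMaximizer (c · E) f = leastMaximizer E f
  leastMaximizer (E₁ ⊕[ p ] E₂) f = (s , h s) , max , least
    where
    best : ∀ s₁ → ∃ (LeastMaximizer E₂ (λ s₂ → f (s₁ , s₂)))
    best s₁ = leastMaximizer E₂ (λ s₂ → f (s₁ , s₂))
    h : Str E₁ → Str E₂
    h s₁ = proj₁ (best s₁)
    g : Str E₁ → R
    g s₁ = f (s₁ , h s₁)
    h-max : ∀ s₁ s₂ → f (s₁ , s₂) ≤ᴿ g s₁
    h-max s₁ = proj₁ (proj₂ (best s₁))
    outer : ∃ (LeastMaximizer E₁ g)
    outer = leastMaximizer E₁ g
    s : Str E₁
    s = proj₁ outer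
    max : Maximizes f (s , h s)
    max (t₁ , t₂) = ≤ᴿ-trans (h-max t₁ t₂) (proj₁ (proj₂ outer) t₁)
    least : ∀ t → Maximizes f t → StrLE (E₁ ⊕[ p ] E₂) (s , h s) t
    least (t₁ , t₂) m
      with proj₂ (proj₂ outer) t₁ (λ u → ≤ᴿ-trans (m (u , h u)) (h-max t₁ t₂))
    ... | inj₂ lt = inj₂ (inj₁ lt)
    ... | inj₁ refl with proj₂ (proj₂ (best s)) t₂ (λ u → m (s , u))
    ...   | inj₁ refl = inj₁ refl
    ...   | inj₂ lt   = inj₂ (inj₂ (refl , lt))

  optimal : ∀ {σ} (E : EffVal σ) → Str E
  optimal E = proj₁ (leastMaximizer E (Rew E))

  Opₛ : ∀ {σ} → Program σ → DW (Val σ)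
  Opₛ M = Out (Op M) (optimal (Op M))

module Observation (𝓡 : Reals) (𝓢 : Signature 𝓡) (𝓦 : RewardStructure 𝓡)
                   (𝓘 : Interpretation 𝓡 𝓢 𝓦) where
  open Signature 𝓢
  open RewardStructure 𝓦
  open Interpretation 𝓘
  open Syntax 𝓡 𝓢 public
  open Distributions 𝓡
  open Selection 𝓡 𝓢 𝓦 𝓘

  ObsEq : (S : Setoid 0ℓ 0ℓ) → (Program (base bool) → Setoid.Carrier S) →
          ∀ {σ} → Program σ → Program σ → Set
  ObsEq S Ob {σ} M N = (C : Hole σ [] (base bool)) → Setoid._≈_ S (Ob (fill C M)) (Ob (fill C N))

  _≟ᵛ_ : DecidableEquality (Val (base bool))
  con c ≟ᵛ con c′ =
    Dec.map′ (λ e → cong con (⟦⟧ᶜ-injective e)) (λ { refl → refl }) (⟦ c ⟧ᶜ Bool.≟ ⟦ c′ ⟧ᶜ)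

  VDisSetoid : Setoid 0ℓ 0ℓ
  VDisSetoid = distSetoid (Val (base bool)) _≟ᵛ_

  Ob-VDis : Program (base bool) → Dist (Val (base bool))
  Ob-VDis M = VDis (Opₛ M)

  Ob-T₃ : Program (base bool) → Dist (Val (base bool)) × R
  Ob-T₃ M = VDis (Opₛ M) , 𝐄 (Opₛ M)

  infix 4 _≈T₃_ _≈VDis_
  _≈T₃_ _≈VDis_ : ∀ {σ} → Program σ → Program σ → Set
  _≈T₃_   = ObsEq (×-setoid VDisSetoid (setoid R)) Ob-T₃
  _≈VDis_ = ObsEq VDisSetoid Ob-VDis

{-# OPTIONS --safe #-}

-- Suppose that C[M] has smaller maximal reward than C[N].  In the context
--   (if C[M] then tt else tt) or (if C[ ] then ff else ff)
-- the rewards of the two branches tie at M, so that the tie-break selects tt,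
-- while at N the right branch is strictly better and ff is selected.  Hence the
-- value distribution already separates M from N.
module Submission where

open import Defs
open import Data.Empty using (⊥-elim; ⊥-elim-irr)
open import Data.List.Base using (List; []; _∷_; _++_)
open import Data.List.Properties using (map-++; map-∘)
open import Data.Product.Base using (∃; _×_; _,_; proj₁; proj₂)
open import Data.Sum.Base using (inj₁; inj₂)
open import Function.Base using (_∘_)
open import Function.Bundles using (_⇔_; mk⇔)
open import Relation.Binary.Bundles using (Setoid)
open import Relation.Binary.Definitions using (DecidableEquality)
open import Relation.Binary.PropositionalEquality
  using (_≡_; _≢_; refl; sym; trans; cong; cong₂; subst; subst₂; module ≡-Reasoning)
open import Relation.Binary.Structures using (IsDecTotalOrder)
open import Relation.Nullary using (¬_; yes; no)

module DistributionLemmas (𝓡 : Reals) where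
  open Reals 𝓡
  open Distributions 𝓡

  -- The field `weighted` is irrelevant, so distributions with the same list of terms are equal. The
  -- laws below therefore hold up to `≡`, without comparing masses.
  dist-≡ : {X : Set} {μ ν : Dist X} → terms μ ≡ terms ν → μ ≡ ν
  dist-≡ refl = refl

  mapᴰ-∘ : {X Y Z : Set} (f : Y → Z) (g : X → Y) (μ : Dist X) → mapᴰ f (mapᴰ g μ) ≡ mapᴰ (f ∘ g) μ
  mapᴰ-∘ f g μ = dist-≡ (sym (map-∘ (terms μ)))

  weights-map-scale : {X Y : Set} (f : X → Y) (a : ℝ) (l : List (ℝ × X)) →
                      scale a (weights-map f l) ≡ weights-map f (scale a l)
  weights-map-scale f a l = trans (sym (map-∘ l)) (map-∘ l)

  mapᴰ-mixᴰ : {X Y : Set} (f : X → Y) (p : Probability.Prob 𝓡) (μ ν : Dist X) →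
              mixᴰ p (mapᴰ f μ) (mapᴰ f ν) ≡ mapᴰ f (mixᴰ p μ ν)
  mapᴰ-mixᴰ f p μ ν = dist-≡
    (trans (cong₂ _++_ (weights-map-scale f _ (terms μ)) (weights-map-scale f _ (terms ν)))
           (sym (map-++ _ (scale _ (terms μ)) (scale _ (terms ν)))))

  module _ {X Y : Set} (_≟ʸ_ : DecidableEquality Y) (y : Y) where

    mass-const : (l : List (ℝ × X)) → mass _≟ʸ_ (weights-map (λ _ → y) l) y ≡ total l
    mass-const []            = refl
    mass-const ((w , _) ∷ l) with y ≟ʸ y
    ... | yes _  = cong (w +_) (mass-const l)
    ... | no y≢y = ⊥-elim (y≢y refl)

    mass-const-≢ : ∀ {z} → y ≢ z → (l : List (ℝ × X)) → mass _≟ʸ_ (weights-map (λ _ → y) l) z ≡ 0#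
    mass-const-≢     y≢z []      = refl
    mass-const-≢ {z} y≢z (_ ∷ l) with y ≟ʸ z
    ... | yes y≡z = ⊥-elim (y≢z y≡z)
    ... | no _    = trans (+-identityˡ _) (mass-const-≢ y≢z l)

  -- At the point `y` the first distribution has the whole mass 1 and the second has mass 0.
  const-separates : {X X′ Y : Set} (_≟ʸ_ : DecidableEquality Y) {y z : Y} → z ≢ y →
                    (μ : Dist X) (ν : Dist X′) →
                    ¬ Setoid._≈_ (distSetoid Y _≟ʸ_) (mapᴰ (λ _ → y) μ) (mapᴰ (λ _ → z) ν)
  const-separates _≟ʸ_ {y} {z} z≢y (dist l h) (dist k _) e =
    -- The proof `h` that the weights sum to 1 is irrelevant, so it may only feed an irrelevant
    -- contradiction.
    ⊥-elim-irr (0≢1 (trans (sym total≡0) (proj₂ h)))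
    where
    total≡0 : total l ≡ 0#
    total≡0 = trans (sym (mass-const _≟ʸ_ y l)) (trans (e y) (mass-const-≢ _≟ʸ_ z z≢y k))

module MaximalReward (𝓡 : Reals) (𝓢 : Signature 𝓡) (𝓦 : RewardStructure 𝓡)
                     (𝓘 : Interpretation 𝓡 𝓢 𝓦) where
  open RewardStructure 𝓦
  open Interpretation 𝓘
  open Syntax 𝓡 𝓢
  open Evaluation 𝓡 𝓢
  open Distributions 𝓡
  open DistributionLemmas 𝓡
  open ConvexCombination 𝓡 𝓦
  open Selection 𝓡 𝓢 𝓦 𝓘
  open Termination 𝓡 𝓢 𝓦 𝓘
  open Determinism 𝓡 𝓢 𝓦 𝓘 using (⇓-deterministic)
  open IsDecTotalOrder ≤ᴿ-isDecTotalOrder using () renaming (antisym to ≤ᴿ-antisym)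

  relabel : ∀ {σ τ} → (Val σ → Val τ) → EffVal σ → EffVal τ
  relabel f (leaf V)       = leaf (f V)
  relabel f (E₁ or E₂)     = relabel f E₁ or relabel f E₂
  relabel f (c · E)        = c · relabel f E
  relabel f (E₁ ⊕[ p ] E₂) = relabel f E₁ ⊕[ p ] relabel f E₂

  -- `Op` is extracted from the termination proof; determinism lets any derivation compute it.
  Op-unique : ∀ {σ} {M : Program σ} {E} → M ⇓ E → Op M ≡ E
  Op-unique {M = M} = ⇓-deterministic (proj₂ (terminates M))

  -- An effect raised by `M` in the context `𝓕` is raised by `plug 𝓔 M` in `𝓔 ⊙ 𝓕`, so `𝓔` keeps the
  -- shape of the tree and acts only at the leaves.
  plug-⇓-relabel : ∀ {σ τ} (𝓔 : ECxt σ τ) (f : Val σ → Val τ) →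
                   (∀ V → plug 𝓔 ⌜ V ⌝ ⇓ leaf (f V)) →
                   ∀ {M E} → M ⇓ E → plug 𝓔 M ⇓ relabel f E
  plug-⇓-relabel {σ} 𝓔 f k = go
    where
    inner : ∀ {υ} (𝓕 : ECxt υ σ) {M E} → plug 𝓔 (plug 𝓕 M) ⇓ E → plug (𝓔 ⊙ 𝓕) M ⇓ E
    inner 𝓕 {M} = subst (_⇓ _) (sym (plug-⊙ 𝓔 𝓕 M))
    outer : ∀ {υ} (𝓕 : ECxt υ σ) {M E} → plug (𝓔 ⊙ 𝓕) M ⇓ E → plug 𝓔 (plug 𝓕 M) ⇓ E
    outer 𝓕 {M} = subst (_⇓ _) (plug-⊙ 𝓔 𝓕 M)
    go : ∀ {M E} → M ⇓ E → plug 𝓔 M ⇓ relabel f E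
    go (return V)       = k V
    go (step s d)       = step (⟶-plug 𝓔 s) (go d)
    go (choose 𝓕 d₁ d₂) = outer 𝓕 (choose (𝓔 ⊙ 𝓕) (inner 𝓕 (go d₁)) (inner 𝓕 (go d₂)))
    go (mix 𝓕 d₁ d₂)    = outer 𝓕 (mix (𝓔 ⊙ 𝓕) (inner 𝓕 (go d₁)) (inner 𝓕 (go d₂)))
    go (rew 𝓕 d)        = outer 𝓕 (rew (𝓔 ⊙ 𝓕) (inner 𝓕 (go d)))

  onValue : ∀ {X Y : Set} → (X → Y) → R × X → R × Y
  onValue f (r , x) = r , f x

  -- `Str` depends only on the shape of the tree, which `relabel` preserves, but the two types agree
  -- only after case analysis on `E`. Hence explicit translations.
  push : ∀ {σ τ} (f : Val σ → Val τ) (E : EffVal σ) → Str E → Str (relabel f E)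
  push f (leaf V)       s         = s
  push f (E₁ or E₂)     (inj₁ s)  = inj₁ (push f E₁ s)
  push f (E₁ or E₂)     (inj₂ s)  = inj₂ (push f E₂ s)
  push f (c · E)        s         = push f E s
  push f (E₁ ⊕[ p ] E₂) (s₁ , s₂) = push f E₁ s₁ , push f E₂ s₂

  pull : ∀ {σ τ} (f : Val σ → Val τ) (E : EffVal σ) → Str (relabel f E) → Str E
  pull f (leaf V)       s         = s
  pull f (E₁ or E₂)     (inj₁ s)  = inj₁ (pull f E₁ s)
  pull f (E₁ or E₂)     (inj₂ s)  = inj₂ (pull f E₂ s)
  pull f (c · E)        s         = pull f E s
  pull f (E₁ ⊕[ p ] E₂) (s₁ , s₂) = pull f E₁ s₁ , pull f E₂ s₂

  -- Every strategy of the relabelled tree is thus a `push`, so the laws for `push` cover them all.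
  push-pull : ∀ {σ τ} (f : Val σ → Val τ) (E : EffVal σ) s → push f E (pull f E s) ≡ s
  push-pull f (leaf V)       s         = refl
  push-pull f (E₁ or E₂)     (inj₁ s)  = cong inj₁ (push-pull f E₁ s)
  push-pull f (E₁ or E₂)     (inj₂ s)  = cong inj₂ (push-pull f E₂ s)
  push-pull f (c · E)        s         = push-pull f E s
  push-pull f (E₁ ⊕[ p ] E₂) (s₁ , s₂) = cong₂ _,_ (push-pull f E₁ s₁) (push-pull f E₂ s₂)

  Out-push : ∀ {σ τ} (f : Val σ → Val τ) (E : EffVal σ) s →
             Out (relabel f E) (push f E s) ≡ mapᴰ (onValue f) (Out E s)
  Out-push f (leaf V)       s        = refl
  Out-push f (E₁ or E₂)     (inj₁ s) = Out-push f E₁ s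
  Out-push f (E₁ or E₂)     (inj₂ s) = Out-push f E₂ s
  Out-push f (c · E)        s        =
    -- Adding a reward and changing the value act on different components, so both orders fuse to
    -- the same map.
    trans (cong (⟦ c ⟧ᶜ ⊙ᴿ_) (Out-push f E s))
          (trans (mapᴰ-∘ _ _ (Out E s)) (sym (mapᴰ-∘ _ _ (Out E s))))
  Out-push f (E₁ ⊕[ p ] E₂) (s₁ , s₂) =
    trans (cong₂ (mixᴰ p) (Out-push f E₁ s₁) (Out-push f E₂ s₂))
          (mapᴰ-mixᴰ _ p (Out E₁ s₁) (Out E₂ s₂))

  Rew-push : ∀ {σ τ} (f : Val σ → Val τ) (E : EffVal σ) s →
             Rew (relabel f E) (push f E s) ≡ Rew E s
  Rew-push f E s = cong ∑ (trans (cong (mapᴰ proj₁) (Out-push f E s)) (mapᴰ-∘ _ _ (Out E s)))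

  -- A Dirac distribution at `V` with its weight still split over the outcomes, the form that
  -- `const-separates` takes.
  VDis-const : ∀ {σ τ} (V : Val τ) (E : EffVal σ) s →
               VDis (Out (relabel (λ _ → V) E) s) ≡
               mapᴰ (λ _ → V) (Out E (pull (λ _ → V) E s))
  VDis-const V E s = begin
    VDis (Out (relabel f E) s)                       ≡⟨ cong (VDis ∘ Out (relabel f E)) (push-pull f E s) ⟨
    VDis (Out (relabel f E) (push f E (pull f E s))) ≡⟨ cong VDis (Out-push f E (pull f E s)) ⟩
    VDis (mapᴰ (onValue f) (Out E (pull f E s)))     ≡⟨ mapᴰ-∘ _ _ (Out E (pull f E s)) ⟩
    mapᴰ (λ _ → V) (Out E (pull f E s))              ∎
    where
    open ≡-Reasoning
    f = λ _ → V

  -- `maxRew (Op M)` unfolds to `𝐄 (Opₛ M)`, the reward that `Ob-T₃` observes.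
  maxRew : ∀ {σ} → EffVal σ → R
  maxRew E = Rew E (optimal E)

  optimal-max : ∀ {σ} (E : EffVal σ) s → Rew E s ≤ᴿ maxRew E
  optimal-max E = proj₁ (proj₂ (leastMaximizer E (Rew E)))

  -- Translating an optimal strategy of either tree gives a strategy of the other with the same
  -- reward.
  maxRew-relabel : ∀ {σ τ} (f : Val σ → Val τ) (E : EffVal σ) → maxRew (relabel f E) ≡ maxRew E
  maxRew-relabel f E = ≤ᴿ-antisym
    (subst (_≤ᴿ maxRew E)
           (trans (sym (Rew-push f E _)) (cong (Rew (relabel f E)) (push-pull f E _)))
           (optimal-max E (pull f E (optimal (relabel f E)))))
    (subst (_≤ᴿ maxRew (relabel f E)) (Rew-push f E (optimal E))
           (optimal-max (relabel f E) (push f E (optimal E))))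

  -- Repeating the comparison on which `leastMaximizer` branches makes `optimal` reduce. A tie goes
  -- to the left.
  optimal-or-left : ∀ {σ} (E₁ E₂ : EffVal σ) → maxRew E₂ ≤ᴿ maxRew E₁ →
                    optimal (E₁ or E₂) ≡ inj₁ (optimal E₁)
  optimal-or-left E₁ E₂ 2≤1 with maxRew E₂ ≤ᴿ? maxRew E₁
  ... | yes _  = refl
  ... | no 2≰1 = ⊥-elim (2≰1 2≤1)

  optimal-or-right : ∀ {σ} (E₁ E₂ : EffVal σ) → ¬ maxRew E₂ ≤ᴿ maxRew E₁ →
                     optimal (E₁ or E₂) ≡ inj₂ (optimal E₂)
  optimal-or-right E₁ E₂ 2≰1 with maxRew E₂ ≤ᴿ? maxRew E₁
  ... | yes 2≤1 = ⊥-elim (2≰1 2≤1)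
  ... | no _    = refl

  -- With equal branches the value of `L` is forgotten and only its effects remain.
  ite-⇓ : ∀ {σ} (V : Val σ) {L E} → L ⇓ E → ite L ⌜ V ⌝ ⌜ V ⌝ ⇓ relabel (λ _ → V) E
  ite-⇓ V = plug-⇓-relabel (ite □ ⌜ V ⌝ ⌜ V ⌝) (λ _ → V) λ { (con c) → branch c }
    where
    branch : ∀ c → ite (con c) ⌜ V ⌝ ⌜ V ⌝ ⇓ leaf V
    -- The conditional reduces only at `ttᶜ` or `ffᶜ`; injectivity of denotations rules out other
    -- Boolean constants.
    branch c with boolean c
    ... | inj₁ refl = step (ξ □ tt) (return V)
    ... | inj₂ refl = step (ξ □ ff) (return V)

  race : ∀ {σ} → Val σ → Val σ → Program (base bool) → Program (base bool) → Program σ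
  race V W P Q = ite P ⌜ V ⌝ ⌜ V ⌝ or ite Q ⌜ W ⌝ ⌜ W ⌝

  module _ {σ : Ty} (V W : Val σ) (P Q : Program (base bool)) where
    private
      E₁ = relabel (λ _ → V) (Op P)
      E₂ = relabel (λ _ → W) (Op Q)

      -- The strategy `s` is a variable so that matching on `refl` replaces it by the optimal one,
      -- and no transport between strategy types arises.
      outcome : ∀ s → optimal (E₁ or E₂) ≡ s → Opₛ (race V W P Q) ≡ Out (E₁ or E₂) s
      outcome s refl = cong (λ E → Out E (optimal E))
        (Op-unique (choose □ (ite-⇓ V (proj₂ (terminates P))) (ite-⇓ W (proj₂ (terminates Q)))))

    race-left : maxRew (Op Q) ≤ᴿ maxRew (Op P) →
                ∃ λ (μ : DW (Val (base bool))) → VDis (Opₛ (race V W P Q)) ≡ mapᴰ (λ _ → V) μ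
    race-left Q≤P = Out (Op P) (pull (λ _ → V) (Op P) (optimal E₁)) ,
      trans (cong VDis (outcome _ (optimal-or-left E₁ E₂ 2≤1)))
            (VDis-const V (Op P) (optimal E₁))
      where
      2≤1 : maxRew E₂ ≤ᴿ maxRew E₁
      2≤1 = subst₂ _≤ᴿ_ (sym (maxRew-relabel (λ _ → W) (Op Q)))
                       (sym (maxRew-relabel (λ _ → V) (Op P))) Q≤P

    race-right : ¬ maxRew (Op Q) ≤ᴿ maxRew (Op P) →
                 ∃ λ (μ : DW (Val (base bool))) → VDis (Opₛ (race V W P Q)) ≡ mapᴰ (λ _ → W) μ
    race-right Q≰P = Out (Op Q) (pull (λ _ → W) (Op Q) (optimal E₂)) ,
      trans (cong VDis (outcome _ (optimal-or-right E₁ E₂ 2≰1)))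
            (VDis-const W (Op Q) (optimal E₂))
      where
      2≰1 : ¬ maxRew E₂ ≤ᴿ maxRew E₁
      2≰1 = Q≰P ∘ subst₂ _≤ᴿ_ (maxRew-relabel (λ _ → W) (Op Q)) (maxRew-relabel (λ _ → V) (Op P))

module _ (𝓡 : Reals) (𝓢 : Signature 𝓡) (𝓦 : RewardStructure 𝓡) (𝓘 : Interpretation 𝓡 𝓢 𝓦) where
  open Signature 𝓢
  open RewardStructure 𝓦
  open Observation 𝓡 𝓢 𝓦 𝓘
  open DistributionLemmas 𝓡
  open Selection 𝓡 𝓢 𝓦 𝓘
  open Determinism 𝓡 𝓢 𝓦 𝓘 using (tt≢ff)
  open MaximalReward 𝓡 𝓢 𝓦 𝓘

  ≈VDis⇒𝐄-≤ : ∀ {σ} {M N : Program σ} → M ≈VDis N → (C : Hole σ [] (base bool)) →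
              𝐄 (Opₛ (fill C N)) ≤ᴿ 𝐄 (Opₛ (fill C M))
  ≈VDis⇒𝐄-≤ {M = M} {N} M≈N C with 𝐄 (Opₛ (fill C N)) ≤ᴿ? 𝐄 (Opₛ (fill C M))
  ... | yes N≤M = N≤M
  ... | no N≰M
    -- At `M` the program `fill C M` races against itself, so reflexivity gives the tie.
    with race-left (con ttᶜ) (con ffᶜ) (fill C M) (fill C M) ≤ᴿ-refl
       | race-right (con ttᶜ) (con ffᶜ) (fill C M) (fill C N) N≰M
  ...   | μ , at-M | ν , at-N =
    ⊥-elim (const-separates _≟ᵛ_ (λ { refl → tt≢ff refl }) μ ν
      (subst₂ (Setoid._≈_ VDisSetoid) at-M at-N
        -- The left competitor is the fixed program `fill C M`; only the right one contains the
        -- hole. Both fillings unfold to `race`.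
        (M≈N (or₂ (ite (fill C M) (con ttᶜ) (con ttᶜ)) (ite₁ C (con ffᶜ) (con ffᶜ))))))

theorem5p17 : (𝓡 : Reals) (𝓢 : Signature 𝓡) (𝓦 : RewardStructure 𝓡) (𝓘 : Interpretation 𝓡 𝓢 𝓦) →
    let open Observation 𝓡 𝓢 𝓦 𝓘 in
    (σ : Ty) (M N : Program σ) → M ≈T₃ N ⇔ M ≈VDis N
theorem5p17 𝓡 𝓢 𝓦 𝓘 σ M N = mk⇔
  (λ M≈N C → proj₁ (M≈N C))
  (λ M≈N C → M≈N C ,
    -- Each orientation of the symmetric hypothesis gives one inequality.
    ≤ᴿ-antisym (≈VDis⇒𝐄-≤ 𝓡 𝓢 𝓦 𝓘 (λ D x → sym (M≈N D x)) C) (≈VDis⇒𝐄-≤ 𝓡 𝓢 𝓦 𝓘 M≈N C))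
  where
  open IsDecTotalOrder (RewardStructure.≤ᴿ-isDecTotalOrder 𝓦) using () renaming (antisym to ≤ᴿ-antisym)
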